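{- Let $\mathbb{F}$ be either the field of real numbers or a finite field in which $-3$ is a quadratic non-residue. For $n\ge 4$ and $2\le d\le n-2$, the elementary symmetric polynomial $S_n^d\in\mathbb{F}[x_1,\ldots,x_n]$ is not expressible as a read-once determinant over $\mathbb{F}$; that is, there is no matrix $M$ (of any size) with entries in $\{x_1,\ldots,x_n\}\cup\mathbb{F}$, in which each variable occurs in at most one position, such that $\det(M)=S_n^d$.
   Context: $S_n^d(x_1,\ldots,x_n)=\sum_{A\subseteq\{1,\ldots,n\},|A|=d}\prod_{i\in A}x_i$. -}

module Defs where

open import Level using (Level; _⊔_) renaming (suc to lsuc)
open import Algebra.Bundles using (CommutativeRing)
open import Data.Nat as ℕ using (ℕ; zero; suc)
open import Data.Fin as Fin using (Fin; zero; suc; punchIn)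
open import Data.Bool using (Bool; true; false; if_then_else_)
open import Data.Vec as Vec using (Vec; []; _∷_)
open import Data.Vec.Properties using (≡-dec)
open import Data.List as List using (List; []; _∷_; _++_; map; concatMap; filter)
open import Data.Product using (Σ; ∃; _×_; _,_; proj₁; proj₂)
open import Data.Sum using (_⊎_; inj₁; inj₂)
open import Relation.Nullary using (¬_; yes; no)
open import Relation.Binary.PropositionalEquality using (_≡_)
open import Data.Fin.Subset using (Subset; ∣_∣)

record Field (c ℓ : Level) : Set (lsuc (c ⊔ ℓ)) where
  field
    commRing : CommutativeRing c ℓ
  open CommutativeRing commRing public
  field
    1≉0     : ¬ (1# ≈ 0#)
    inverse : ∀ x → ¬ (x ≈ 0#) → ∃ λ y → x * y ≈ 1#

module _ {c ℓ : Level} (F : Field c ℓ) where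
  open Field F using (Carrier; _≈_; _+_; _*_; -_; 0#; 1#)

  IsFinite : Set (c ⊔ ℓ)
  IsFinite = Σ ℕ λ k → Σ (Fin k → Carrier) λ f → ∀ x → ∃ λ i → f i ≈ x

  minusThree : Carrier
  minusThree = - (1# + 1# + 1#)

  MinusThreeNonResidue : Set (c ⊔ ℓ)
  MinusThreeNonResidue = ¬ (∃ λ y → y * y ≈ minusThree)

  -- F is (isomorphic to) the field of real numbers: a Dedekind-complete
  -- ordered field (this axiomatically characterises ℝ up to isomorphism).
  record IsReals : Set (lsuc (c ⊔ ℓ)) where
    field
      _≤_       : Carrier → Carrier → Set ℓ
      ≤-resp-≈  : ∀ {x x' y y'} → x ≈ x' → y ≈ y' → x ≤ y → x' ≤ y'
      ≤-refl    : ∀ x → x ≤ x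
      ≤-trans   : ∀ {x y z} → x ≤ y → y ≤ z → x ≤ z
      ≤-antisym : ∀ {x y} → x ≤ y → y ≤ x → x ≈ y
      ≤-total   : ∀ x y → (x ≤ y) ⊎ (y ≤ x)
      +-mono    : ∀ {x y} z → x ≤ y → (x + z) ≤ (y + z)
      *-nonneg  : ∀ {x y} → 0# ≤ x → 0# ≤ y → 0# ≤ (x * y)
      sup : (P : Carrier → Set (c ⊔ ℓ)) → (∃ λ x → P x) →
            (∃ λ b → ∀ x → P x → x ≤ b) →
            ∃ λ s → (∀ x → P x → x ≤ s) ×
                    (∀ b → (∀ x → P x → x ≤ b) → s ≤ b)

  -- Polynomials in n variables over F, as formal finite sums of terms
  -- c · x^e with e : Vec ℕ n an exponent vector.  Two polynomials are
  -- equal iff every monomial has the same coefficient.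

  Monomial : ℕ → Set
  Monomial n = Vec ℕ n

  Poly : ℕ → Set c
  Poly n = List (Carrier × Monomial n)

  module _ {n : ℕ} where
    coeff : Poly n → Monomial n → Carrier
    coeff []             m = 0#
    coeff ((a , e) ∷ ts) m with ≡-dec ℕ._≟_ e m
    ... | yes _ = a + coeff ts m
    ... | no  _ = coeff ts m

    _≃_ : Poly n → Poly n → Set ℓ
    p ≃ q = ∀ m → coeff p m ≈ coeff q m

    const : Carrier → Poly n
    const a = (a , Vec.replicate n 0) ∷ []

    var : Fin n → Poly n
    var i = (1# , Vec.updateAt (Vec.replicate n 0) i (λ _ → 1)) ∷ []

    _⊕_ : Poly n → Poly n → Poly n
    p ⊕ q = p ++ q

    neg : Poly n → Poly n
    neg = map (λ { (a , e) → (- a , e) })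

    _⊗_ : Poly n → Poly n → Poly n
    p ⊗ q = concatMap (λ { (a , e) → map (λ { (b , f) → (a * b , Vec.zipWith ℕ._+_ e f) }) q }) p

    Entry : Set c
    Entry = Fin n ⊎ Carrier

    ⟦_⟧ : Entry → Poly n
    ⟦ inj₁ i ⟧ = var i
    ⟦ inj₂ a ⟧ = const a

    det : (k : ℕ) → (Fin k → Fin k → Poly n) → Poly n
    det zero    A = const 1#
    det (suc k) A = go (suc k) (λ j → j) true
      where
      minor : Fin (suc k) → Fin k → Fin k → Poly n
      minor j r s = A (suc r) (punchIn j s)
      term : Fin (suc k) → Poly n
      term j = A zero j ⊗ det k (minor j)
      go : (m : ℕ) → (Fin m → Fin (suc k)) → Bool → Poly n
      go zero    col s = []
      go (suc m) col s =
        (if s then term (col zero) else neg (term (col zero)))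
          ⊕ go m (λ j → col (suc j)) (if s then false else true)

    ReadOnce : {k : ℕ} → (Fin k → Fin k → Entry) → Set c
    ReadOnce {k} M = ∀ (p q r s : Fin k) (i : Fin n) →
      M p q ≡ inj₁ i → M r s ≡ inj₁ i → (p ≡ r) × (q ≡ s)

    IsReadOnceDet : Poly n → Set (c ⊔ ℓ)
    IsReadOnceDet P = Σ ℕ λ k → Σ (Fin k → Fin k → Entry) λ M →
      ReadOnce M × (det k (λ r s → ⟦ M r s ⟧) ≃ P)

  allSubsets : (n : ℕ) → List (Subset n)
  allSubsets zero    = [] ∷ []
  allSubsets (suc n) = map (true ∷_) (allSubsets n) ++ map (false ∷_) (allSubsets n)

  S : (n d : ℕ) → Poly n
  S n d = map (λ A → (1# , Vec.map (λ b → if b then 1 else 0) A))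
              (filter (λ A → ∣ A ∣ ℕ.≟ d) (allSubsets n))

{-# OPTIONS --safe #-}
module Submission where

-- Evaluating a read-once determinant equal to S_n^d at points of F shows that each variable occurs,
-- and that no two share a column, since a product of both occurs in S_n^d.  Hence the columns of the
-- variables are aᵢ + xᵢ eᵢ, and as a function of these columns the determinant is an alternating
-- n-form ω whose value at a choice of aᵢ or eᵢ for each i is 1 if exactly d of the eᵢ are chosen and
-- 0 otherwise.  Freezing n − 4 of the columns, d − 2 of them at eᵢ and the others at aᵢ, leaves a
-- form in four vectors with the same property for d = 2.  By Cramer's rule ω satisfies the
-- Grassmann–Plücker relations, so its values are 4 × 4 determinants in coordinates with respect to
-- e₀, e₁, a₂, a₃; the sixteen values thus prescribe the principal minors of a 4 × 4 matrix with zero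
-- diagonal.  The minors of order 2 and 3 leave an off-diagonal block form, and the one of order 4
-- then gives X² − X + 1 = 0 for a product X of four entries, that is (2X − 1)² = −3.

-- The Grassmann-Plücker relations carry the proof because a general alternating 4-form on eight
-- independent vectors aᵢ, eᵢ can take any sixteen values on the choices. Only for a form like ω, a
-- determinant with frozen columns, are these values tied together as the principal minors of one
-- matrix.
--
-- The reference e₀, e₁, a₂, a₃ is a choice on which ω is 1, so coordinates need no division.
-- Exchanging one of its vectors leaves one or three of the eᵢ, hence the zero diagonal. Exchanging
-- two leaves two of the eᵢ exactly when one index is from {0,1} and the other from {2,3}, hence the
-- blocks. Finally -3 is the discriminant of X² - X + 1.
--
-- Everything is affine in each single variable, so differences of values at 0 and 1 recover
-- coefficients; no large supply of points is needed, and a finite F does no harm. Equality in F is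
-- not decidable: an entry with square 0 vanishes only up to double negation, which is enough for a
-- refutation.

import Algebra.Properties.AbelianGroup
import Algebra.Properties.CommutativeMonoid.Sum
import Algebra.Properties.CommutativeSemigroup
import Algebra.Properties.Ring
import Algebra.Properties.Semiring.Exp
import Algebra.Properties.Semiring.Mult
import Algebra.Properties.Semiring.Sum
import Algebra.Solver.Ring
import Relation.Binary.Reasoning.Setoid
open import Algebra.Bundles using (CommutativeRing; RawRing)
open import Algebra.Solver.Ring.AlmostCommutativeRing using (fromCommutativeRing; _-Raw-AlmostCommutative⟶_)
open import Data.Bool using (Bool; true; false; if_then_else_; not; _xor_)
open import Data.Empty using (⊥)
open import Data.Fin as Fin using (Fin; zero; suc; punchIn; punchOut)
import Data.Fin.Properties as Fin
open import Data.Fin.Subset using (Subset; ∣_∣)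
open import Data.List as List using (List)
open import Data.Maybe using (Maybe; just; nothing)
open import Data.Nat as ℕ using (ℕ; zero; suc; _≤_; _∸_)
import Data.Nat.Properties as ℕ
open import Data.Product using (∃; ∃₂; _×_; _,_; proj₁; proj₂)
open import Data.Sum using (_⊎_; inj₁; inj₂)
open import Data.Vec as Vec using (Vec)
open import Data.Vec.Functional using (_∷_; []; foldr; updateAt)
open import Data.Vec.Functional.Properties using (updateAt-updates; updateAt-minimal; updateAt-id-local)
open import Data.Vec.Properties using (≡-dec)
import Defs
open import Defs hiding (const; det)
open import Function using (_∘_; const)
open import Level using (_⊔_)
open import Relation.Binary.PropositionalEquality as ≡ using (_≡_; _≢_)
open import Relation.Nullary using (¬_; Dec; yes; no; does; contradiction)

-- The coefficients are integers, a pair (m , n) standing for m − n: the solver has to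
-- recognise that coefficients cancel, and equality in the ring is not decidable.
-- Pairs are kept in lowest terms, because normal forms are compared as they stand.
module IntegerSolver {c ℓ} (R : CommutativeRing c ℓ) where
  open CommutativeRing R hiding (zero)
  open Algebra.Properties.Ring ring
  open Algebra.Properties.AbelianGroup +-abelianGroup using (⁻¹-∙-comm)
  open Algebra.Properties.CommutativeSemigroup +-commutativeSemigroup using (interchange)
  open Algebra.Properties.Semiring.Mult semiring using (×-homo-+; ×1-homo-*) renaming (_×_ to _·_)
  open Relation.Binary.Reasoning.Setoid setoid

  private
    cancel : ℕ → ℕ → ℕ × ℕ
    cancel a b = a ℕ.∸ b , b ℕ.∸ a

    -- Both sides are the maximum of `a` and `b`.
    cancel-balanced : ∀ a b → (a ℕ.∸ b) ℕ.+ b ≡ a ℕ.+ (b ℕ.∸ a)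
    cancel-balanced zero zero = ≡.refl
    cancel-balanced zero (suc b) = ≡.refl
    cancel-balanced (suc a) zero = ≡.refl
    cancel-balanced (suc a) (suc b) = ≡.trans (ℕ.+-suc (a ℕ.∸ b) b) (≡.cong suc (cancel-balanced a b))

    Coefficient : RawRing _ _
    Coefficient = record
      { Carrier = ℕ × ℕ
      ; _≈_ = ≡._≡_
      ; _+_ = λ (a , b) (a' , b') → cancel (a ℕ.+ a') (b ℕ.+ b')
      ; _*_ = λ (a , b) (a' , b') → cancel (a ℕ.* a' ℕ.+ b ℕ.* b') (a ℕ.* b' ℕ.+ b ℕ.* a')
      ; -_ = λ (a , b) → b , a
      ; 0# = 0 , 0
      ; 1# = 1 , 0
      }

    difference : ℕ × ℕ → Carrier
    difference (a , b) = a · 1# - b · 1#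

    -- 0# and 1# get clauses of their own so that the constants :0 and :1 evaluate to them definitionally.
    ⟪_⟫ : ℕ × ℕ → Carrier
    ⟪ 0 , 0 ⟫ = 0#
    ⟪ 1 , 0 ⟫ = 1#
    ⟪ p ⟫ = difference p

    ⟪⟫≈difference : ∀ p → ⟪ p ⟫ ≈ difference p
    ⟪⟫≈difference (0 , 0) = sym (-‿inverseʳ 0#)
    ⟪⟫≈difference (1 , 0) = sym (trans (+-cong (+-identityʳ 1#) -0#≈0#) (+-identityʳ 1#))
    ⟪⟫≈difference (suc (suc a) , 0) = refl
    ⟪⟫≈difference (0 , suc b) = refl
    ⟪⟫≈difference (1 , suc b) = refl
    ⟪⟫≈difference (suc (suc a) , suc b) = refl

    difference-+ : ∀ p q r s → (p + q) - (r + s) ≈ (p - r) + (q - s)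
    difference-+ p q r s = begin
      (p + q) - (r + s)     ≈⟨ +-congˡ (⁻¹-∙-comm r s) ⟨
      (p + q) + (- r - s)   ≈⟨ interchange p q (- r) (- s) ⟩
      (p - r) + (q - s)     ∎

    difference-* : ∀ p q r s → (p * r + q * s) - (p * s + q * r) ≈ (p - q) * (r - s)
    difference-* p q r s = begin
      (p * r + q * s) - (p * s + q * r)   ≈⟨ difference-+ _ _ _ _ ⟩
      (p * r - p * s) + (q * s - q * r)   ≈⟨ +-cong (x[y-z]≈xy-xz p r s) (x[y-z]≈xy-xz q s r) ⟨
      p * (r - s) + q * (s - r)           ≈⟨ +-congˡ (*-congˡ (⁻¹-anti-homo‿- r s)) ⟨
      p * (r - s) + q * - (r - s)         ≈⟨ +-congˡ (-‿distribʳ-* q (r - s)) ⟨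
      p * (r - s) - q * (r - s)           ≈⟨ [y-z]x≈yx-zx (r - s) p q ⟨
      (p - q) * (r - s)                   ∎

    difference-≡ : ∀ a b a' b' → a ℕ.+ b' ≡ a' ℕ.+ b → difference (a , b) ≈ difference (a' , b')
    difference-≡ a b a' b' e = begin
      x - y                     ≈⟨ +-identityʳ _ ⟨
      (x - y) + 0#              ≈⟨ +-congˡ (-‿inverseʳ y') ⟨
      (x - y) + (y' - y')       ≈⟨ difference-+ x y' y y' ⟨
      (x + y') - (y + y')       ≈⟨ +-cong (×-homo-+ 1# a b') (-‿cong (+-comm y' y)) ⟨
      (a ℕ.+ b') · 1# - (y' + y) ≈⟨ +-congʳ (reflexive (≡.cong (_· 1#) e)) ⟩
      (a' ℕ.+ b) · 1# - (y' + y) ≈⟨ +-congʳ (×-homo-+ 1# a' b) ⟩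
      (x' + y) - (y' + y)       ≈⟨ difference-+ x' y y' y ⟩
      (x' - y') + (y - y)       ≈⟨ +-congˡ (-‿inverseʳ y) ⟩
      (x' - y') + 0#            ≈⟨ +-identityʳ _ ⟩
      x' - y'                   ∎
      where
      x = a · 1# ; y = b · 1# ; x' = a' · 1# ; y' = b' · 1#

    ⟪cancel⟫ : ∀ a b → ⟪ cancel a b ⟫ ≈ a · 1# - b · 1#
    ⟪cancel⟫ a b = trans (⟪⟫≈difference (cancel a b)) (difference-≡ (a ℕ.∸ b) (b ℕ.∸ a) a b (cancel-balanced a b))

    product-sum : ∀ a b c d → (a ℕ.* b ℕ.+ c ℕ.* d) · 1# ≈ (a · 1#) * (b · 1#) + (c · 1#) * (d · 1#)
    product-sum a b c d = trans (×-homo-+ 1# (a ℕ.* b) (c ℕ.* d)) (+-cong (×1-homo-* a b) (×1-homo-* c d))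

    morphism : Coefficient -Raw-AlmostCommutative⟶ fromCommutativeRing R
    morphism = record
      { ⟦_⟧ = ⟪_⟫
      ; +-homo = λ p@(a , b) q@(a' , b') → trans (⟪cancel⟫ (a ℕ.+ a') (b ℕ.+ b'))
          (trans (trans (+-cong (×-homo-+ 1# a a') (-‿cong (×-homo-+ 1# b b'))) (difference-+ _ _ _ _))
            (sym (+-cong (⟪⟫≈difference p) (⟪⟫≈difference q))))
      ; *-homo = λ p@(a , b) q@(a' , b') → trans (⟪cancel⟫ (a ℕ.* a' ℕ.+ b ℕ.* b') (a ℕ.* b' ℕ.+ b ℕ.* a'))
          (trans (trans (+-cong (product-sum a a' b b') (-‿cong (product-sum a b' b a'))) (difference-* _ _ _ _))
            (sym (*-cong (⟪⟫≈difference p) (⟪⟫≈difference q))))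
      ; -‿homo = λ p@(a , b) → trans (⟪⟫≈difference (b , a))
          (trans (sym (⁻¹-anti-homo‿- (a · 1#) (b · 1#))) (-‿cong (sym (⟪⟫≈difference p))))
      ; 0-homo = refl
      ; 1-homo = refl
      }

    _≟_ : ∀ x y → Maybe (⟪ x ⟫ ≈ ⟪ y ⟫)
    (a , b) ≟ (a' , b') with a ℕ.+ b' ℕ.≟ a' ℕ.+ b
    ... | no _ = nothing
    ... | yes e = just (trans (⟪⟫≈difference (a , b))
                    (trans (difference-≡ a b a' b' e) (sym (⟪⟫≈difference (a' , b')))))

  open Algebra.Solver.Ring Coefficient (fromCommutativeRing R) morphism _≟_ public
    using (Polynomial; con; solve; _:=_; _:+_; _:*_; _:-_; :-_)

  :0 :1 : ∀ {n} → Polynomial n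
  :0 = con (0 , 0)
  :1 = con (1 , 0)

-- Adjacent positions and the omission of a position

data Adjacent : ∀ {n} → Fin n → Fin n → Set where
  here  : ∀ {n} → Adjacent {suc (suc n)} zero (suc zero)
  there : ∀ {n} {i j : Fin n} → Adjacent i j → Adjacent (suc i) (suc j)

-- Omitting either of two neighbours leaves the other one in the same slot, so the remaining
-- sequences differ there at most.
punchIn-adjacent : ∀ {n} {a b : Fin (suc n)} → Adjacent a b → ∀ s →
  punchIn a s ≡ punchIn b s ⊎ (punchIn a s ≡ b × punchIn b s ≡ a)
punchIn-adjacent here zero = inj₂ (≡.refl , ≡.refl)
punchIn-adjacent here (suc s) = inj₁ ≡.refl
punchIn-adjacent (there p) zero = inj₁ ≡.refl
punchIn-adjacent (there p) (suc s) with punchIn-adjacent p s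
... | inj₁ e = inj₁ (≡.cong suc e)
... | inj₂ (e , e') = inj₂ (≡.cong suc e , ≡.cong suc e')

-- No third position lies between two neighbours, so omitting one keeps them adjacent. In a Laplace
-- expansion the minors for such `t` still contain both columns side by side.
adjacent-view : ∀ {n} {a b : Fin (suc n)} → Adjacent a b → ∀ t →
  t ≡ a ⊎ t ≡ b ⊎ ∃₂ λ a' b' → Adjacent a' b' × punchIn t a' ≡ a × punchIn t b' ≡ b
adjacent-view here zero = inj₁ ≡.refl
adjacent-view here (suc zero) = inj₂ (inj₁ ≡.refl)
adjacent-view {suc (suc n)} here (suc (suc t)) = inj₂ (inj₂ (zero , suc zero , here , ≡.refl , ≡.refl))
adjacent-view (there p) zero = inj₂ (inj₂ (_ , _ , p , ≡.refl , ≡.refl))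
adjacent-view {suc n} (there p) (suc t) with adjacent-view p t
... | inj₁ e = inj₁ (≡.cong suc e)
... | inj₂ (inj₁ e) = inj₂ (inj₁ (≡.cong suc e))
... | inj₂ (inj₂ (_ , _ , q , e , e')) =
  inj₂ (inj₂ (_ , _ , there q , ≡.cong suc e , ≡.cong suc e'))

-- Multilinear and alternating forms

module MultilinearForms {c ℓ} (R : CommutativeRing c ℓ) where
  open CommutativeRing R hiding (zero)
  open Algebra.Properties.Ring ring using (-0#≈0#)
  open Algebra.Properties.Semiring.Sum semiring using (sum; sum-cong-≋; sum-replicate-zero; *-distribˡ-sum)
  open Algebra.Properties.CommutativeMonoid.Sum +-commutativeMonoid using (∑-distrib-+)
  open IntegerSolver R
  open Relation.Binary.Reasoning.Setoid setoid

  V : ℕ → Set c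
  V k = Fin k → Carrier

  infix 4 _≋_
  _≋_ : ∀ {k} → V k → V k → Set ℓ
  u ≋ v = ∀ r → u r ≈ v r

  infixl 6 _+[_]_
  _+[_]_ : ∀ {k} → V k → Carrier → V k → V k
  (u +[ a ] v) r = u r + a * v r

  ≡⇒≋ : ∀ {k} {u v : V k} → u ≡ v → u ≋ v
  ≡⇒≋ ≡.refl _ = refl

  sum-zero : ∀ {n} {f : V n} → (∀ i → f i ≈ 0#) → sum f ≈ 0#
  sum-zero {n} f≈0 = trans (sum-cong-≋ f≈0) (sum-replicate-zero n)

  sum-linear : ∀ {n} {f g h : V n} a → f ≋ g +[ a ] h → sum f ≈ sum g + a * sum h
  sum-linear {f = f} {g} {h} a e = begin
    sum f                       ≈⟨ sum-cong-≋ e ⟩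
    sum (g +[ a ] h)            ≈⟨ ∑-distrib-+ g (λ i → a * h i) ⟩
    sum g + sum (λ i → a * h i) ≈⟨ +-congˡ (*-distribˡ-sum a h) ⟨
    sum g + a * sum h           ∎

  sum-adjacent : ∀ {n} {a b : Fin n} → Adjacent a b → (f : V n) →
    (∀ t → t ≢ a → t ≢ b → f t ≈ 0#) → f a + f b ≈ 0# → sum f ≈ 0#
  sum-adjacent here f z e = begin
    f zero + (f (suc zero) + sum (λ i → f (suc (suc i)))) ≈⟨ +-congˡ (+-congˡ (sum-zero λ i → z (suc (suc i)) (λ ()) (λ ()))) ⟩
    f zero + (f (suc zero) + 0#)                  ≈⟨ +-congˡ (+-identityʳ _) ⟩
    f zero + f (suc zero)                         ≈⟨ e ⟩
    0#                                            ∎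
  sum-adjacent (there p) f z e = begin
    f zero + sum (f ∘ suc) ≈⟨ +-cong (z zero (λ ()) (λ ()))
                                (sum-adjacent p (f ∘ suc)
                                  (λ t t≢a t≢b → z (suc t) (t≢a ∘ Fin.suc-injective) (t≢b ∘ Fin.suc-injective)) e) ⟩
    0# + 0#                ≈⟨ +-identityʳ 0# ⟩
    0#                     ∎

  record Linear {k} (φ : V k → Carrier) : Set (c ⊔ ℓ) where
    field
      cong   : ∀ {u v} → u ≋ v → φ u ≈ φ v
      linear : ∀ u a v → φ (u +[ a ] v) ≈ φ u + a * φ v

  -- Linearity in slot `j` relates any three families that agree off `j` up to `≋`. Families are
  -- functions, so a formulation by updates of one family would have to be carried along pointwise
  -- equalities at each use.
  record Multilinear {k n} (ω : (Fin n → V k) → Carrier) : Set (c ⊔ ℓ) where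
    field
      cong   : ∀ {y z} → (∀ i → y i ≋ z i) → ω y ≈ ω z
      linear : ∀ j {y u v} a → (∀ i → i ≢ j → y i ≋ u i) → (∀ i → i ≢ j → y i ≋ v i) →
               y j ≋ u j +[ a ] v j → ω y ≈ ω u + a * ω v


  record Alternating {k n} (ω : (Fin n → V k) → Carrier) : Set (c ⊔ ℓ) where
    field
      multilinear : Multilinear ω
      alternating : ∀ {i j} → i ≢ j → ∀ {y} → y i ≋ y j → ω y ≈ 0#
    open Multilinear multilinear public

  slot-linear : ∀ {k n} {ω : (Fin n → V k) → Carrier} → Multilinear ω →
    ∀ y j → Linear (λ v → ω (updateAt y j (const v)))
  slot-linear {ω = ω} ml y j = record
    { cong = λ {u} {v} u≋v → cong λ i → update-cong i u≋v
    ; linear = λ u a v → linear j a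
        (λ i i≢j → ≡⇒≋ (≡.trans (updateAt-minimal i j y i≢j) (≡.sym (updateAt-minimal i j y i≢j))))
        (λ i i≢j → ≡⇒≋ (≡.trans (updateAt-minimal i j y i≢j) (≡.sym (updateAt-minimal i j y i≢j))))
        λ r → trans (at-j r) (+-cong (sym (at-j r)) (*-congˡ (sym (at-j r))))
    }
    where
    open Multilinear ml
    at-j : ∀ {v} → updateAt y j (const v) j ≋ v
    at-j = ≡⇒≋ (updateAt-updates j y)
    update-cong : ∀ i {u v} → u ≋ v → updateAt y j (const u) i ≋ updateAt y j (const v) i
    update-cong i u≋v with i Fin.≟ j
    ... | yes ≡.refl = λ r → trans (at-j r) (trans (u≋v r) (sym (at-j r)))
    ... | no i≢j = ≡⇒≋ (≡.trans (updateAt-minimal i j y i≢j) (≡.sym (updateAt-minimal i j y i≢j)))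

  module _ {k n} {ω : (Fin (suc n) → V k) → Carrier} (ml : Multilinear ω) where
    open Multilinear ml

    head-linear : ∀ y → Linear (λ v → ω (v ∷ y))
    head-linear y = record
      { cong = λ u≋v → cong λ { zero → u≋v ; (suc i) r → refl }
      ; linear = λ u a v → linear zero a
          (λ { zero 0≢0 → contradiction ≡.refl 0≢0 ; (suc i) _ r → refl })
          (λ { zero 0≢0 → contradiction ≡.refl 0≢0 ; (suc i) _ r → refl }) (λ r → refl)
      }

    fix-multilinear : ∀ v → Multilinear (λ y → ω (v ∷ y))
    fix-multilinear v = record
      { cong = λ e → cong λ { zero r → refl ; (suc i) → e i }
      ; linear = λ j a e e' → linear (suc j) a
          (λ { zero _ r → refl ; (suc i) i≢j → e i (i≢j ∘ ≡.cong suc) })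
          (λ { zero _ r → refl ; (suc i) i≢j → e' i (i≢j ∘ ≡.cong suc) })
      }

  fix-alternating : ∀ {k n} {ω : (Fin (suc n) → V k) → Carrier} → Alternating ω →
    ∀ v → Alternating (λ y → ω (v ∷ y))
  fix-alternating alt v = record
    { multilinear = fix-multilinear multilinear v
    ; alternating = λ i≢j → alternating (i≢j ∘ Fin.suc-injective)
    } where open Alternating alt

  linear-zero : ∀ {k} {φ : V k → Carrier} → Linear φ → φ (const 0#) ≈ 0#
  linear-zero {φ = φ} l = begin
    φ 0⃗                ≈⟨ cong (λ r → sym (solve 0 (:0 :+ (:- :1) :* :0 := :0) refl)) ⟩
    φ (0⃗ +[ - 1# ] 0⃗)  ≈⟨ linear 0⃗ (- 1#) 0⃗ ⟩
    φ 0⃗ + - 1# * φ 0⃗   ≈⟨ solve 1 (λ p → p :+ (:- :1) :* p := :0) refl (φ 0⃗) ⟩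
    0#                 ∎
    where
    open Linear l
    0⃗ = const 0#

  linear-sum : ∀ {k} {φ : V k → Carrier} → Linear φ → ∀ {m} (a : V m) (b : Fin m → V k) →
    φ (λ r → sum λ i → a i * b i r) ≈ sum λ i → a i * φ (b i)
  linear-sum l {zero} a b = linear-zero l
  linear-sum {φ = φ} l {suc m} a b = begin
    φ (λ r → a zero * b zero r + tail r)    ≈⟨ cong (λ r → +-comm _ _) ⟩
    φ (tail +[ a zero ] b zero)             ≈⟨ linear tail (a zero) (b zero) ⟩
    φ tail + a zero * φ (b zero)            ≈⟨ +-comm _ _ ⟩
    a zero * φ (b zero) + φ tail            ≈⟨ +-congˡ (linear-sum l (a ∘ suc) (b ∘ suc)) ⟩
    a zero * φ (b zero) + sum (λ i → a (suc i) * φ (b (suc i))) ∎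
    where
    open Linear l
    tail : V _
    tail r = sum λ i → a (suc i) * b (suc i) r

  δ : ∀ {k} → Fin k → V k
  δ zero    zero    = 1#
  δ zero    (suc r) = 0#
  δ (suc i) zero    = 0#
  δ (suc i) (suc r) = δ i r

  basis-expansion : ∀ {k} (v : V k) → v ≋ λ r → sum λ i → v i * δ i r
  basis-expansion v zero = sym (begin
    v zero * 1# + sum (λ i → v (suc i) * 0#) ≈⟨ +-cong (*-identityʳ _) (sum-zero λ i → zeroʳ (v (suc i))) ⟩
    v zero + 0#                              ≈⟨ +-identityʳ _ ⟩
    v zero                                   ∎)
  basis-expansion v (suc r) = sym (begin
    v zero * 0# + sum (λ i → v (suc i) * δ i r) ≈⟨ +-cong (zeroʳ _) (sym (basis-expansion (v ∘ suc) r)) ⟩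
    0# + v (suc r)                              ≈⟨ +-identityˡ _ ⟩
    v (suc r)                                   ∎)

  zero-on-basis : ∀ {k n} {ω : (Fin n → V k) → Carrier} → Multilinear ω →
    (∀ (f : Fin n → Fin k) → ω (δ ∘ f) ≈ 0#) → ∀ y → ω y ≈ 0#
  zero-on-basis {n = zero} ml z y = trans (Multilinear.cong ml (λ ())) (z λ ())
  zero-on-basis {n = suc n} {ω} ml z y = begin
    ω y                                                  ≈⟨ Multilinear.cong ml (λ { zero → λ _ → refl ; (suc i) r → refl }) ⟩
    ω (y zero ∷ y ∘ suc)                                 ≈⟨ Linear.cong head (basis-expansion (y zero)) ⟩
    ω ((λ r → sum λ i → y zero i * δ i r) ∷ y ∘ suc)     ≈⟨ linear-sum head (y zero) δ ⟩
    sum (λ i → y zero i * ω (δ i ∷ y ∘ suc))             ≈⟨ sum-zero (λ i → trans (*-congˡ (rest i)) (zeroʳ _)) ⟩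
    0#                                                   ∎
    where
    head = head-linear ml (y ∘ suc)
    rest : ∀ i → ω (δ i ∷ y ∘ suc) ≈ 0#
    rest i = zero-on-basis (fix-multilinear ml (δ i))
      (λ f → trans (Multilinear.cong ml λ { zero r → refl ; (suc s) r → refl }) (z (i ∷ f))) (y ∘ suc)

  -- It suffices to test on basis vectors, and among more than `k` of these two coincide.
  alternating-vanishes : ∀ {k n} {ω : (Fin n → V k) → Carrier} → Alternating ω → k ℕ.< n → ∀ y → ω y ≈ 0#
  alternating-vanishes alt k<n = zero-on-basis multilinear λ f →
    let i , j , i<j , fi≡fj = Fin.pigeonhole k<n f
    in alternating (λ i≡j → Fin.<-irrefl i≡j i<j) (≡⇒≋ (≡.cong δ fi≡fj))
    where open Alternating alt

  -- Polarisation: expand `ω` with u + v in both leading slots, where it vanishes together with the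
  -- two diagonal terms.
  swap-head : ∀ {k n} {ω : (Fin (suc (suc n)) → V k) → Carrier} → Multilinear ω →
    (∀ v y → ω (v ∷ v ∷ y) ≈ 0#) → ∀ u v y → ω (u ∷ v ∷ y) ≈ - ω (v ∷ u ∷ y)
  swap-head {k} {n} {ω} ml z u v y = begin
    ω (u ∷ v ∷ y)     ≈⟨ solve 4 (λ uu uv vu vv → uv := ((uu :+ :1 :* uv) :+ :1 :* (vu :+ :1 :* vv)) :- uu :- vv :- vu) refl
                           (ω (u ∷ u ∷ y)) (ω (u ∷ v ∷ y)) (ω (v ∷ u ∷ y)) (ω (v ∷ v ∷ y)) ⟩
    ((ω (u ∷ u ∷ y) + 1# * ω (u ∷ v ∷ y)) + 1# * (ω (v ∷ u ∷ y) + 1# * ω (v ∷ v ∷ y)))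
      - ω (u ∷ u ∷ y) - ω (v ∷ v ∷ y) - ω (v ∷ u ∷ y)
                      ≈⟨ +-congʳ (+-cong (+-cong (sym expand) (-‿cong (z u y))) (-‿cong (z v y))) ⟩
    ω (s ∷ s ∷ y) - 0# - 0# - ω (v ∷ u ∷ y)   ≈⟨ +-congʳ (+-congʳ (+-congʳ (z s y))) ⟩
    0# - 0# - 0# - ω (v ∷ u ∷ y)   ≈⟨ solve 1 (λ p → :0 :- :0 :- :0 :- p := :- p) refl _ ⟩
    - ω (v ∷ u ∷ y)   ∎
    where
    s = u +[ 1# ] v
    second : ∀ w → ω (w ∷ s ∷ y) ≈ ω (w ∷ u ∷ y) + 1# * ω (w ∷ v ∷ y)
    second w = Linear.linear (head-linear (fix-multilinear ml w) y) u 1# v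
    expand : ω (s ∷ s ∷ y) ≈ (ω (u ∷ u ∷ y) + 1# * ω (u ∷ v ∷ y)) + 1# * (ω (v ∷ u ∷ y) + 1# * ω (v ∷ v ∷ y))
    expand = trans (Linear.linear (head-linear ml (s ∷ y)) u 1# v) (+-cong (second u) (*-congˡ (second v)))

  -- Swapping the earlier of the two equal vectors with its successor costs a sign; the vector it
  -- has passed is then fixed, and the induction continues in a form with one slot less, until the
  -- two are neighbours.
  adjacent⇒alternating : ∀ {k n} {ω : (Fin n → V k) → Carrier} → Multilinear ω →
    (∀ {i j} → Adjacent i j → ∀ {y} → y i ≋ y j → ω y ≈ 0#) → Alternating ω
  adjacent⇒alternating ml adj = record { multilinear = ml ; alternating = λ i≢j e → go ml adj _ _ i≢j _ e }
    where
    AdjacentAlternating : ∀ {k n} → ((Fin n → V k) → Carrier) → Set _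
    AdjacentAlternating ω = ∀ {i j} → Adjacent i j → ∀ {y} → y i ≋ y j → ω y ≈ 0#

    η : ∀ {k n} {ω : (Fin (suc n) → V k) → Carrier} → Multilinear ω → ∀ y → ω y ≈ ω (y zero ∷ y ∘ suc)
    η ml y = Multilinear.cong ml λ { zero r → refl ; (suc i) r → refl }

    zero-suc : ∀ {k n} {ω : (Fin (suc n) → V k) → Carrier} → Multilinear ω → AdjacentAlternating ω →
      ∀ j y → y zero ≋ y (suc j) → ω y ≈ 0#
    zero-suc ml adj zero y e = adj here e
    zero-suc {ω = ω} ml adj (suc j) y e = begin
      ω y                                                   ≈⟨ Multilinear.cong ml (λ { zero r → refl ; (suc zero) r → refl ; (suc (suc i)) r → refl }) ⟩
      ω (y zero ∷ y (suc zero) ∷ (λ i → y (suc (suc i))))             ≈⟨ swap-head ml (λ v y → adj here (λ r → refl)) _ _ _ ⟩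
      - ω (y (suc zero) ∷ y zero ∷ (λ i → y (suc (suc i))))           ≈⟨ -‿cong (zero-suc (fix-multilinear ml (y (suc zero))) (λ p → adj (there p)) j _ e) ⟩
      - 0#                                                  ≈⟨ -0#≈0# ⟩
      0#                                                    ∎

    go : ∀ {k n} {ω : (Fin n → V k) → Carrier} → Multilinear ω → AdjacentAlternating ω →
      ∀ i j → i ≢ j → ∀ y → y i ≋ y j → ω y ≈ 0#
    go ml adj zero zero 0≢0 y e = contradiction ≡.refl 0≢0
    go ml adj zero (suc j) _ y e = zero-suc ml adj j y e
    go ml adj (suc i) zero _ y e = zero-suc ml adj i y (λ r → sym (e r))
    go ml adj (suc i) (suc j) i≢j y e =
      trans (η ml y) (go (fix-multilinear ml (y zero)) (λ p → adj (there p)) i j (i≢j ∘ ≡.cong suc) (y ∘ suc) e)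

  sg : ∀ {n} → Fin n → Carrier
  sg zero    = 1#
  sg (suc i) = - sg i

  sg² : ∀ {n} (i : Fin n) → sg i * sg i ≈ 1#
  sg² zero = *-identityʳ 1#
  sg² (suc i) = trans (solve 1 (λ s → (:- s) :* (:- s) := s :* s) refl (sg i)) (sg² i)

  sg-adjacent : ∀ {n} {i j : Fin n} → Adjacent i j → sg j ≈ - sg i
  sg-adjacent here = refl
  sg-adjacent (there p) = -‿cong (sg-adjacent p)

  -- One swap, hence one sign, for each of the vectors in front of `b j`.
  move-to-head : ∀ {k n} {ω : (Fin (suc n) → V k) → Carrier} → Alternating ω →
    ∀ (b : Fin (suc n) → V k) j → ω (b j ∷ b ∘ punchIn j) ≈ sg j * ω b
  move-to-head {ω = ω} alt b zero =
    trans (Alternating.cong alt λ { zero r → refl ; (suc i) r → refl }) (sym (*-identityˡ _))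
  move-to-head {n = suc n} {ω} alt b (suc j) = begin
    ω (b (suc j) ∷ b ∘ punchIn (suc j))                   ≈⟨ cong (λ { zero r → refl ; (suc zero) r → refl ; (suc (suc i)) r → refl }) ⟩
    ω (b (suc j) ∷ b zero ∷ (λ i → b (suc (punchIn j i))))          ≈⟨ swap-head multilinear (λ v y → alternating {zero} {suc zero} (λ ()) (λ r → refl)) _ _ _ ⟩
    - ω (b zero ∷ b (suc j) ∷ (λ i → b (suc (punchIn j i))))        ≈⟨ -‿cong (move-to-head (fix-alternating alt (b zero)) (b ∘ suc) j) ⟩
    - (sg j * ω (b zero ∷ b ∘ suc))                       ≈⟨ -‿cong (*-congˡ (cong λ { zero r → refl ; (suc i) r → refl })) ⟩
    - (sg j * ω b)                                        ≈⟨ solve 2 (λ s w → :- (s :* w) := (:- s) :* w) refl (sg j) (ω b) ⟩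
    - sg j * ω b                                          ∎
    where open Alternating alt

-- Determinants and Cramer's rule

module Determinants {c ℓ} (R : CommutativeRing c ℓ) where
  open CommutativeRing R hiding (zero)
  open Algebra.Properties.Ring ring using (-1*x≈-x)
  open Algebra.Properties.Semiring.Sum semiring using (sum; sum-cong-≋; *-distribˡ-sum)
  open IntegerSolver R
  open MultilinearForms R
  open Relation.Binary.Reasoning.Setoid setoid

  -- The vectors are the columns of the matrix.
  det : ∀ k → (Fin k → V k) → Carrier
  det zero    y = 1#
  det (suc k) y = sum λ j → sg j * (y j zero * det k λ s r → y (punchIn j s) (suc r))

  det-multilinear : ∀ k → Multilinear (det k)
  det-multilinear zero = record { cong = λ _ → refl ; linear = λ () }
  det-multilinear (suc k) = record
    { cong = λ {y} {z} e → sum-cong-≋ λ j →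
        *-congˡ {sg j} (*-cong (e j zero) (cong {λ s r → y (punchIn j s) (suc r)} λ s r → e (punchIn j s) (suc r)))
    ; linear = linear′
    }
    where
    open Multilinear (det-multilinear k)
    minor : (Fin (suc k) → V (suc k)) → Fin (suc k) → Fin k → V k
    minor y j s r = y (punchIn j s) (suc r)
    linear′ : ∀ j {y u v} a → (∀ i → i ≢ j → y i ≋ u i) → (∀ i → i ≢ j → y i ≋ v i) →
              y j ≋ u j +[ a ] v j → det (suc k) y ≈ det (suc k) u + a * det (suc k) v
    linear′ j {y} {u} {v} a e e' ej = sum-linear a term
      where
      term : ∀ t → sg t * (y t zero * det k (minor y t)) ≈
                   sg t * (u t zero * det k (minor u t)) + a * (sg t * (v t zero * det k (minor v t)))
      term t with t Fin.≟ j
      ... | yes ≡.refl = begin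
        sg t * (y t zero * det k (minor y t))
          ≈⟨ *-congˡ (*-cong (ej zero) (cong λ s r → e (punchIn t s) (Fin.punchInᵢ≢i t s) (suc r))) ⟩
        sg t * ((u t zero + a * v t zero) * det k (minor u t))
          ≈⟨ solve 5 (λ g p α q m → g :* ((p :+ α :* q) :* m) := g :* (p :* m) :+ α :* (g :* (q :* m))) refl
               (sg t) (u t zero) a (v t zero) (det k (minor u t)) ⟩
        sg t * (u t zero * det k (minor u t)) + a * (sg t * (v t zero * det k (minor u t)))
          ≈⟨ +-congˡ (*-congˡ (*-congˡ (*-congˡ (cong λ s r →
               trans (sym (e (punchIn t s) (Fin.punchInᵢ≢i t s) (suc r))) (e' (punchIn t s) (Fin.punchInᵢ≢i t s) (suc r)))))) ⟩
        sg t * (u t zero * det k (minor u t)) + a * (sg t * (v t zero * det k (minor v t))) ∎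
      -- Here the varying column lies inside the minor, in the slot `j'` that `punchIn t` sends to
      -- `j`; in the case above it supplied the leading entry and was absent from the minor.
      ... | no t≢j = begin
        sg t * (y t zero * det k (minor y t))
          ≈⟨ *-congˡ (*-congˡ (linear j' a (λ i i≢j' r → e _ (off i≢j') (suc r)) (λ i i≢j' r → e' _ (off i≢j') (suc r)) at)) ⟩
        sg t * (y t zero * (det k (minor u t) + a * det k (minor v t)))
          ≈⟨ solve 5 (λ g p α m m' → g :* (p :* (m :+ α :* m')) := g :* (p :* m) :+ α :* (g :* (p :* m'))) refl
               (sg t) (y t zero) a (det k (minor u t)) (det k (minor v t)) ⟩
        sg t * (y t zero * det k (minor u t)) + a * (sg t * (y t zero * det k (minor v t)))
          ≈⟨ +-cong (*-congˡ (*-congʳ (e t t≢j zero))) (*-congˡ (*-congˡ (*-congʳ (e' t t≢j zero)))) ⟩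
        sg t * (u t zero * det k (minor u t)) + a * (sg t * (v t zero * det k (minor v t))) ∎
        where
        j' = punchOut t≢j
        back : punchIn t j' ≡ j
        back = Fin.punchIn-punchOut t≢j
        off : ∀ {i} → i ≢ j' → punchIn t i ≢ j
        off i≢j' eq = i≢j' (Fin.punchIn-injective t _ _ (≡.trans eq (≡.sym back)))
        at : minor y t j' ≋ minor u t j' +[ a ] minor v t j'
        at r = ≡.subst (λ i → y i (suc r) ≈ u i (suc r) + a * v i (suc r)) (≡.sym back) (ej (suc r))

  -- Two equal neighbouring columns leave equal minors with opposite signs, and every other minor
  -- again has two equal neighbouring columns. For equal columns further apart the two minors would
  -- differ by a permutation, so these are left to the general lemma on forms.
  det-alternating : ∀ k → Alternating (det k)
  det-alternating k = adjacent⇒alternating (det-multilinear k) (adjacent k)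
    where
    adjacent : ∀ k {i j} → Adjacent i j → ∀ {y} → y i ≋ y j → det k y ≈ 0#
    adjacent (suc k) {i} {j} p {y} e = sum-adjacent p term other pair
      where
      minor : Fin (suc k) → Fin k → V k
      minor t s r = y (punchIn t s) (suc r)
      term : Fin (suc k) → Carrier
      term t = sg t * (y t zero * det k (minor t))
      other : ∀ t → t ≢ i → t ≢ j → term t ≈ 0#
      other t t≢i t≢j with adjacent-view p t
      ... | inj₁ t≡i = contradiction t≡i t≢i
      ... | inj₂ (inj₁ t≡j) = contradiction t≡j t≢j
      ... | inj₂ (inj₂ (i' , j' , p' , ei , ej)) = begin
        sg t * (y t zero * det k (minor t)) ≈⟨ *-congˡ (*-congˡ (adjacent k p' λ r →
                                                 ≡.subst₂ (λ a b → y a (suc r) ≈ y b (suc r)) (≡.sym ei) (≡.sym ej) (e (suc r)))) ⟩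
        sg t * (y t zero * 0#)              ≈⟨ solve 2 (λ g p → g :* (p :* :0) := :0) refl (sg t) (y t zero) ⟩
        0#                                  ∎
      same-minor : ∀ s → minor i s ≋ minor j s
      same-minor s r with punchIn-adjacent p s
      ... | inj₁ eq = reflexive (≡.cong (λ a → y a (suc r)) eq)
      ... | inj₂ (eq , eq') = begin
        y (punchIn i s) (suc r) ≡⟨ ≡.cong (λ a → y a (suc r)) eq ⟩
        y j (suc r)             ≈⟨ e (suc r) ⟨
        y i (suc r)             ≡⟨ ≡.cong (λ a → y a (suc r)) eq' ⟨
        y (punchIn j s) (suc r) ∎
      pair : term i + term j ≈ 0#
      pair = begin
        term i + sg j * (y j zero * det k (minor j))
          ≈⟨ +-congˡ (*-cong (sg-adjacent p) (*-cong (sym (e zero)) (sym (Multilinear.cong (det-multilinear k) same-minor)))) ⟩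
        term i + - sg i * (y i zero * det k (minor i))
          ≈⟨ solve 2 (λ g q → g :* q :+ (:- g) :* q := :0) refl (sg i) (y i zero * det k (minor i)) ⟩
        0# ∎

  -- Without `z j`, the family `u ∷ z` is `u` followed by the other vectors; moving `u` into the
  -- vacant slot produces the sign.
  head-update : ∀ {k n} {ω : (Fin n → V k) → Carrier} → Alternating ω → ∀ z j u →
    ω (λ s → (u ∷ z) (punchIn (suc j) s)) ≈ sg j * ω (updateAt z j (const u))
  head-update {n = suc n} alt z j u = trans
    (cong λ { zero → ≡⇒≋ (≡.sym (updateAt-updates j z))
            ; (suc s) → ≡⇒≋ (≡.sym (updateAt-minimal (punchIn j s) j z (Fin.punchInᵢ≢i j s))) })
    (move-to-head alt (updateAt z j (const u)) j)
    where open Alternating alt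

  -- Cramer's rule: bordering the columns u, z₀, …, zₖ₋₁ by a first row of values of φ gives
  -- an alternating form in k + 1 vectors of dimension k, which vanishes.
  cramer : ∀ {k} {φ : V k → Carrier} → Linear φ → ∀ (z : Fin k → V k) u →
    det k z * φ u ≈ sum λ j → det k (updateAt z j (const u)) * φ (z j)
  cramer {k} {φ} φ-linear z u = begin
    det k z * φ u
      ≈⟨ solve 3 (λ d p s → d :* p := (:1 :* (p :* d) :+ s) :- s) refl (det k z) (φ u) rest ⟩
    (1# * (φ u * det k z) + rest) - rest
      ≈⟨ +-congʳ (alternating-vanishes bordered (ℕ.n<1+n k) (u ∷ z)) ⟩
    0# - rest
      ≈⟨ +-identityˡ _ ⟩
    - rest
      ≈⟨ -1*x≈-x rest ⟨
    - 1# * rest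
      ≈⟨ *-distribˡ-sum (- 1#) (λ j → sg (suc j) * (φ (z j) * det k (others j))) ⟩
    sum (λ j → - 1# * (sg (suc j) * (φ (z j) * det k (others j))))
      ≈⟨ sum-cong-≋ term ⟩
    sum (λ j → det k (updateAt z j (const u)) * φ (z j)) ∎
    where
    open Linear φ-linear renaming (cong to φ-cong; linear to φ-lin)
    module Det {k} = Alternating (det-alternating k)
    border : V k → V (suc k)
    border v = φ v ∷ v
    bordered : Alternating (λ (y : Fin (suc k) → V k) → det (suc k) (λ i → border (y i)))
    bordered = record
      { multilinear = record
        { cong = λ e → Det.cong λ i → border-cong (e i)
        ; linear = λ j a e e' ej → Det.linear j a (λ i i≢j → border-cong (e i i≢j)) (λ i i≢j → border-cong (e' i i≢j))
            λ { zero → trans (φ-cong ej) (φ-lin _ a _) ; (suc r) → ej r }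
        }
      ; alternating = λ i≢j e → Det.alternating i≢j (border-cong e)
      }
      where
      border-cong : ∀ {v w} → v ≋ w → border v ≋ border w
      border-cong e zero = φ-cong e
      border-cong e (suc r) = e r
    others : ∀ j → Fin k → V k
    others j s = (u ∷ z) (punchIn (suc j) s)
    rest = sum λ j → sg (suc j) * (φ (z j) * det k (others j))
    term : ∀ j → - 1# * (sg (suc j) * (φ (z j) * det k (others j))) ≈ det k (updateAt z j (const u)) * φ (z j)
    term j = begin
      - 1# * (- sg j * (φ (z j) * det k (others j)))
        ≈⟨ *-congˡ (*-congˡ (*-congˡ (head-update (det-alternating k) z j u))) ⟩
      - 1# * (- sg j * (φ (z j) * (sg j * det k (updateAt z j (const u)))))
        ≈⟨ solve 3 (λ g p d → (:- :1) :* ((:- g) :* (p :* (g :* d))) := (g :* g) :* (d :* p)) refl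
             (sg j) (φ (z j)) (det k (updateAt z j (const u))) ⟩
      (sg j * sg j) * (det k (updateAt z j (const u)) * φ (z j))
        ≈⟨ *-congʳ (sg² j) ⟩
      1# * (det k (updateAt z j (const u)) * φ (z j))
        ≈⟨ *-identityˡ _ ⟩
      det k (updateAt z j (const u)) * φ (z j) ∎

-- Laplace expansion over arbitrary operations

module Laplace {a} {A : Set a} (_+_ _*_ : A → A → A) (-_ : A → A) (0# 1# : A) where

  sign : ∀ {n} → Fin n → A
  sign zero    = 1#
  sign (suc i) = - sign i

  -- The operations are parameters so that one definition serves both for elements of the ring and
  -- for the solver's polynomials, in which the minors of order up to four are expanded.
  laplace : ∀ n → (Fin n → Fin n → A) → A
  laplace zero    m = 1#
  laplace (suc n) m =
    foldr _+_ 0# λ c → sign c * (m zero c * laplace n λ r s → m (suc r) (punchIn c s))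

-- Forms satisfying the Grassmann-Plücker relations

module ExchangeForms {c ℓ} (R : CommutativeRing c ℓ) where
  open CommutativeRing R hiding (zero)
  open Algebra.Properties.Semiring.Sum semiring using (sum; sum-cong-≋; *-distribʳ-sum)
  open Algebra.Properties.CommutativeMonoid.Sum +-commutativeMonoid using (sum-remove)
  open IntegerSolver R
  open MultilinearForms R
  open Determinants R
  open Laplace _+_ _*_ -_ 0# 1# using (laplace)
  open Relation.Binary.Reasoning.Setoid setoid

  -- The Grassmann–Plücker relations.
  Exchange : ∀ {k n} → ((Fin n → V k) → Carrier) → Set _
  Exchange {k} {n} ω = ∀ i y z u →
    ω z * ω (updateAt y i (const u)) ≈
    sum λ j → ω (updateAt z j (const u)) * ω (updateAt y i (const (z j)))

  -- The relation for `v ∷ y` and `v ∷ z` has one extra term, which moves `v` into a family that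
  -- already contains it and so vanishes.
  fix-exchange : ∀ {k n} {ω : (Fin (suc n) → V k) → Carrier} → Alternating ω → Exchange ω →
    ∀ v → Exchange (λ y → ω (v ∷ y))
  fix-exchange {ω = ω} alt ex v i y z u = begin
    ω (v ∷ z) * ω (v ∷ updateAt y i (const u))
      ≈⟨ *-congˡ (push y i u) ⟩
    ω (v ∷ z) * ω (updateAt (v ∷ y) (suc i) (const u))
      ≈⟨ ex (suc i) (v ∷ y) (v ∷ z) u ⟩
    ω (updateAt (v ∷ z) zero (const u)) * ω (updateAt (v ∷ y) (suc i) (const v)) +
      sum (λ j → ω (updateAt (v ∷ z) (suc j) (const u)) * ω (updateAt (v ∷ y) (suc i) (const (z j))))
      ≈⟨ +-cong (trans (*-congˡ (alternating {zero} {suc i} (λ ()) (≡⇒≋ (≡.sym (updateAt-updates i y))))) (zeroʳ _))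
           (sum-cong-≋ λ j → *-cong (sym (push z j u)) (sym (push y i (z j)))) ⟩
    0# + sum (λ j → ω (v ∷ updateAt z j (const u)) * ω (v ∷ updateAt y i (const (z j))))
      ≈⟨ +-identityˡ _ ⟩
    sum (λ j → ω (v ∷ updateAt z j (const u)) * ω (v ∷ updateAt y i (const (z j)))) ∎
    where
    open Alternating alt
    push : ∀ y j u → ω (v ∷ updateAt y j (const u)) ≈ ω (updateAt (v ∷ y) (suc j) (const u))
    push y j u = cong λ { zero r → refl ; (suc s) r → refl }

  sum-image : ∀ {k n} (q : Fin n → Fin k) → (∀ {i j} → q i ≡ q j → i ≡ j) → (f : V k) →
    (∀ j → (∀ i → q i ≢ j) → f j ≈ 0#) → sum f ≈ sum (f ∘ q)
  sum-image {n = zero} q inj f z = sum-zero λ j → z j λ ()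
  sum-image {zero} {suc n} q inj f z = contradiction (q zero) λ ()
  sum-image {suc k} {suc n} q inj f z = begin
    sum f
      ≈⟨ sum-remove {i = q zero} f ⟩
    f (q zero) + sum (f ∘ punchIn (q zero))
      ≈⟨ +-congˡ (sum-image q' q'-inj (f ∘ punchIn (q zero)) λ j j∉q' → z _ λ
           { zero e → Fin.punchInᵢ≢i (q zero) j (≡.sym e)
           ; (suc i) e → j∉q' i (Fin.punchIn-injective (q zero) _ _ (≡.trans (back i) e)) }) ⟩
    f (q zero) + sum (λ i → f (punchIn (q zero) (q' i)))
      ≈⟨ +-congˡ (sum-cong-≋ λ i → reflexive (≡.cong f (back i))) ⟩
    f (q zero) + sum (λ i → f (q (suc i))) ∎
    where
    q≢ : ∀ i → q zero ≢ q (suc i)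
    q≢ i e = contradiction (inj e) λ ()
    q' : Fin n → Fin k
    q' i = punchOut (q≢ i)
    back : ∀ i → punchIn (q zero) (q' i) ≡ q (suc i)
    back i = Fin.punchIn-punchOut (q≢ i)
    q'-inj : ∀ {i j} → q' i ≡ q' j → i ≡ j
    q'-inj e = Fin.suc-injective (inj (Fin.punchOut-injective (q≢ _) (q≢ _) e))

  module Overwrite {k n l} (q : Fin n → Fin l) (q-inj : ∀ {i j} → q i ≡ q j → i ≡ j) (base : Fin l → V k) where

    overwrite : (Fin n → V k) → Fin l → V k
    overwrite y j with Fin.any? (λ i → q i Fin.≟ j)
    ... | yes (i , _) = y i
    ... | no _        = base j

    overwrite-hit : ∀ y i → overwrite y (q i) ≡ y i
    overwrite-hit y i with Fin.any? (λ i' → q i' Fin.≟ q i)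
    ... | yes (i' , e) = ≡.cong y (q-inj e)
    ... | no none      = contradiction (i , ≡.refl) none

    overwrite-miss : ∀ y {j} → (∀ i → q i ≢ j) → overwrite y j ≡ base j
    overwrite-miss y {j} j∉q with Fin.any? (λ i → q i Fin.≟ j)
    ... | yes (i , e) = contradiction e (j∉q i)
    ... | no _        = ≡.refl

    slots : ∀ {p} (P : Fin l → Set p) → (∀ i → P (q i)) → (∀ j → (∀ i → q i ≢ j) → P j) → ∀ j → P j
    slots P hit miss j with Fin.any? (λ i → q i Fin.≟ j)
    ... | yes (i , ≡.refl) = hit i
    ... | no none          = miss j λ i e → none (i , e)

    agree-off : ∀ {y z : Fin n → V k} i → (∀ s → s ≢ i → y s ≋ z s) → ∀ j → j ≢ q i → overwrite y j ≋ overwrite z j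
    agree-off {y} {z} i e = slots (λ j → j ≢ q i → overwrite y j ≋ overwrite z j)
      (λ s qs≢qi r → trans (≡⇒≋ (overwrite-hit y s) r)
        (trans (e s (λ s≡i → qs≢qi (≡.cong q s≡i)) r) (sym (≡⇒≋ (overwrite-hit z s) r))))
      (λ j j∉q _ → ≡⇒≋ (≡.trans (overwrite-miss y j∉q) (≡.sym (overwrite-miss z j∉q))))

    module _ {ω : (Fin l → V k) → Carrier} (alt : Alternating ω) where
      open Alternating alt

      overwrite-alternating : Alternating (λ y → ω (overwrite y))
      overwrite-alternating = record
        { multilinear = record
          { cong = λ {y} {z} e → cong (slots (λ j → overwrite y j ≋ overwrite z j)
              (λ i r → trans (≡⇒≋ (overwrite-hit y i) r) (trans (e i r) (sym (≡⇒≋ (overwrite-hit z i) r))))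
              (λ j j∉q → ≡⇒≋ (≡.trans (overwrite-miss y j∉q) (≡.sym (overwrite-miss z j∉q)))))
          ; linear = λ i {y} {u} {v} a e e' ei → linear (q i) a (agree-off i e) (agree-off i e')
              λ r → trans (≡⇒≋ (overwrite-hit y i) r) (trans (ei r)
                (sym (+-cong (≡⇒≋ (overwrite-hit u i) r) (*-congˡ (≡⇒≋ (overwrite-hit v i) r)))))
          }
        ; alternating = λ {i} {j} i≢j {y} e → alternating (i≢j ∘ q-inj)
            λ r → trans (≡⇒≋ (overwrite-hit y i) r) (trans (e r) (sym (≡⇒≋ (overwrite-hit y j) r)))
        }

  -- Cramer's rule sums over all `k` columns. A frozen column contributes nothing: moved into the
  -- other family, it meets its own copy there.
  overwrite-exchange : ∀ {k n} (q : Fin n → Fin k) (q-inj : ∀ {i j} → q i ≡ q j → i ≡ j) (base : Fin k → V k) →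
    Exchange (λ y → det k (Overwrite.overwrite q q-inj base y))
  overwrite-exchange {k} q q-inj base i y z u = begin
    det k (overwrite z) * φ u
      ≈⟨ cramer (slot-linear Ω.multilinear y i) (overwrite z) u ⟩
    sum term
      ≈⟨ sum-image q q-inj term off-image ⟩
    sum (λ j → det k (updateAt (overwrite z) (q j) (const u)) * φ (overwrite z (q j)))
      ≈⟨ sum-cong-≋ (λ j → *-cong (D.cong (update-hit j)) (Linear.cong (slot-linear Ω.multilinear y i) (≡⇒≋ (overwrite-hit z j)))) ⟩
    sum (λ j → det k (overwrite (updateAt z j (const u))) * φ (z j)) ∎
    where
    open Overwrite q q-inj base
    module D = Alternating (det-alternating k)
    module Ω = Alternating (overwrite-alternating (det-alternating k))
    φ : V k → Carrier
    φ v = det k (overwrite (updateAt y i (const v)))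
    term : V k
    term j = det k (updateAt (overwrite z) j (const u)) * φ (overwrite z j)
    off-image : ∀ j → (∀ s → q s ≢ j) → term j ≈ 0#
    off-image j j∉q = trans (*-congˡ (D.alternating (j∉q i) (≡⇒≋ (≡.trans
      (≡.trans (overwrite-hit _ i) (≡.trans (updateAt-updates i y) (overwrite-miss z j∉q)))
      (≡.sym (overwrite-miss _ j∉q)))))) (zeroʳ _)
    update-hit : ∀ j s → updateAt (overwrite z) (q j) (const u) s ≋ overwrite (updateAt z j (const u)) s
    update-hit j s with s Fin.≟ q j
    ... | yes ≡.refl = ≡⇒≋ (≡.trans (updateAt-updates (q j) (overwrite z))
                              (≡.sym (≡.trans (overwrite-hit _ j) (updateAt-updates j z))))
    ... | no s≢qj = λ r → trans (≡⇒≋ (updateAt-minimal s (q j) (overwrite z) s≢qj) r)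
                       (agree-off j (λ t t≢j → ≡⇒≋ (≡.sym (updateAt-minimal t j z t≢j))) s s≢qj r)

  -- The vectors themselves need not be combinations of the `b c`, and `k` may exceed `n`; the
  -- expansion is only required to hold inside `ω`.
  Coordinates : ∀ {k n} → ((Fin n → V k) → Carrier) → (Fin n → V k) → (V k → V n) → Set _
  Coordinates ω b K = ∀ y i → ω y ≈ sum λ c → K (y i) c * ω (updateAt y i (const (b c)))

  -- Expanding slot 0 puts some `b c` in front. From then on the `b c` coordinate of every other
  -- vector is multiplied by a form with a repeated argument, so column `c` can be struck out;
  -- returning `b c` to its place gives the sign.
  coordinates-laplace : ∀ {k n} {ω : (Fin n → V k) → Carrier} → Alternating ω → ∀ b K → Coordinates ω b K →
    ∀ y → ω y ≈ laplace n (λ r → K (y r)) * ω b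
  coordinates-laplace {n = zero} alt b K co y = trans (Alternating.cong alt λ ()) (sym (*-identityˡ _))
  coordinates-laplace {k} {suc n} {ω} alt b K co y = begin
    ω y
      ≈⟨ co y zero ⟩
    sum (λ c → K (y zero) c * ω (updateAt y zero (const (b c))))
      ≈⟨ sum-cong-≋ term ⟩
    sum (λ c → (sg c * (K (y zero) c * minor c)) * ω b)
      ≈⟨ *-distribʳ-sum (ω b) (λ c → sg c * (K (y zero) c * minor c)) ⟨
    sum (λ c → sg c * (K (y zero) c * minor c)) * ω b
      ≈⟨ *-congʳ (sum-cong-≋ signed) ⟩
    laplace (suc n) (λ r → K (y r)) * ω b ∎
    where
    open Alternating alt
    open Laplace _+_ _*_ -_ 0# 1# using (sign)
    sg≈sign : ∀ {n} (i : Fin n) → sg i ≈ sign i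
    sg≈sign zero = refl
    sg≈sign (suc i) = -‿cong (sg≈sign i)
    minor : Fin (suc n) → Carrier
    minor c = laplace n (λ r s → K (y (suc r)) (punchIn c s))
    signed : ∀ c → sg c * (K (y zero) c * minor c) ≈ sign c * (K (y zero) c * minor c)
    signed c = *-congʳ (sg≈sign c)
    co' : ∀ c → Coordinates (λ y → ω (b c ∷ y)) (b ∘ punchIn c) (λ v s → K v (punchIn c s))
    co' c y i = begin
      ω (b c ∷ y)
        ≈⟨ co (b c ∷ y) (suc i) ⟩
      sum f
        ≈⟨ sum-remove {i = c} f ⟩
      f c + sum (f ∘ punchIn c)
        ≈⟨ +-congʳ (trans (*-congˡ (alternating {zero} {suc i} (λ ()) (≡⇒≋ (≡.sym (updateAt-updates i y))))) (zeroʳ _)) ⟩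
      0# + sum (f ∘ punchIn c)
        ≈⟨ +-identityˡ _ ⟩
      sum (f ∘ punchIn c)
        ≈⟨ sum-cong-≋ pushed ⟩
      sum (λ s → K (y i) (punchIn c s) * ω (b c ∷ updateAt y i (const (b (punchIn c s))))) ∎
      where
      f : V (suc n)
      f c' = K (y i) c' * ω (updateAt (b c ∷ y) (suc i) (const (b c')))
      pushed : ∀ s → f (punchIn c s) ≈ K (y i) (punchIn c s) * ω (b c ∷ updateAt y i (const (b (punchIn c s))))
      pushed s = *-congˡ (cong λ { zero r → refl ; (suc t) r → refl })
    term : ∀ c → K (y zero) c * ω (updateAt y zero (const (b c))) ≈ (sg c * (K (y zero) c * minor c)) * ω b
    term c = begin
      K (y zero) c * ω (updateAt y zero (const (b c)))
        ≈⟨ *-congˡ (cong λ { zero r → refl ; (suc t) r → refl }) ⟩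
      K (y zero) c * ω (b c ∷ y ∘ suc)
        ≈⟨ *-congˡ (coordinates-laplace (fix-alternating alt (b c)) (b ∘ punchIn c) (λ v s → K v (punchIn c s)) (co' c) (y ∘ suc)) ⟩
      K (y zero) c * (minor c * ω (b c ∷ b ∘ punchIn c))
        ≈⟨ *-congˡ (*-congˡ (move-to-head alt b c)) ⟩
      K (y zero) c * (minor c * (sg c * ω b))
        ≈⟨ solve 4 (λ g κ m w → κ :* (m :* (g :* w)) := (g :* (κ :* m)) :* w) refl (sg c) (K (y zero) c) (minor c) (ω b) ⟩
      (sg c * (K (y zero) c * minor c)) * ω b ∎

  -- The exchange relation between `b` and `y` with `u = y i` is already an expansion of `ω y`,
  -- multiplied by `ω b`, which is 1.
  exchange-laplace : ∀ {k n} {ω : (Fin n → V k) → Carrier} → Alternating ω → Exchange ω →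
    ∀ b → ω b ≈ 1# → ∀ y → ω y ≈ laplace n (λ r c → ω (updateAt b c (const (y r))))
  exchange-laplace {ω = ω} alt ex b ωb≈1 y = trans
    (coordinates-laplace alt b (λ u c → ω (updateAt b c (const u))) co y)
    (trans (*-congˡ ωb≈1) (*-identityʳ _))
    where
    open Alternating alt
    co : Coordinates ω b (λ u c → ω (updateAt b c (const u)))
    co y i = begin
      ω y                                        ≈⟨ *-identityˡ _ ⟨
      1# * ω y                                   ≈⟨ *-cong (sym ωb≈1) (cong (λ s → ≡⇒≋ (≡.sym (updateAt-id-local i y ≡.refl s)))) ⟩
      ω b * ω (updateAt y i (const (y i)))       ≈⟨ ex i y b (y i) ⟩
      sum (λ c → ω (updateAt b c (const (y i))) * ω (updateAt y i (const (b c)))) ∎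

-- The obstruction for four vectors

pick : ∀ {a} {A : Set a} {n} → (Fin n → A) → (Fin n → A) → (Fin n → Bool) → Fin n → A
pick a e T i = if T i then e i else a i

-- The determinant with rows minorRow g i (f i) is the principal minor of g on the i for which f i
-- holds; the diagonal of g counts as 0.
minorRow : ∀ {a} {A : Set a} {n} → A → A → (Fin n → Fin n → A) → Fin n → Bool → Fin n → A
minorRow 0# 1# g i flipped j =
  if flipped then (if does (i Fin.≟ j) then 0# else g i j) else (if does (i Fin.≟ j) then 1# else 0#)

-- Greek letters are the entries inside the blocks {0,1} and {2,3}, which will turn out to vanish;
-- Latin letters fill the two off-diagonal blocks.
grid : ∀ {a} {A : Set a} → A → (α p q β r s t u γ w z δ : A) → Fin 4 → Fin 4 → A
grid 0# α p q β r s t u γ w z δ =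
  (0# ∷ α ∷ p ∷ q ∷ []) ∷ (β ∷ 0# ∷ r ∷ s ∷ []) ∷ (t ∷ u ∷ 0# ∷ γ ∷ []) ∷ (w ∷ z ∷ δ ∷ 0# ∷ []) ∷ []

module FourForms {c ℓ} (F : Field c ℓ) where
  open Field F hiding (zero)
  open IntegerSolver commRing
  open Algebra.Properties.Semiring.Sum semiring using (sum-cong-≋)
  open Relation.Binary.Reasoning.Setoid setoid
  open Laplace _+_ _*_ -_ 0# 1# using (sign; laplace)
  private module Syntax {n} = Laplace (_:+_ {n}) _:*_ :-_ :0 :1

  exactly : ∀ n → ℕ → (Fin n → Bool) → Carrier
  exactly zero    zero    T = 1#
  exactly zero    (suc d) T = 0#
  exactly (suc n) zero    T = if T zero then 0# else exactly n zero (T ∘ suc)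
  exactly (suc n) (suc d) T = if T zero then exactly n d (T ∘ suc) else exactly n (suc d) (T ∘ suc)

  laplace-cong : ∀ n {m m' : Fin n → Fin n → Carrier} → (∀ r c → m r c ≈ m' r c) → laplace n m ≈ laplace n m'
  laplace-cong zero e = refl
  laplace-cong (suc n) {m} {m'} e = sum-cong-≋ term
    where
    term : ∀ c → sign c * (m zero c * laplace n (λ r s → m (suc r) (punchIn c s))) ≈
                 sign c * (m' zero c * laplace n (λ r s → m' (suc r) (punchIn c s)))
    term c = *-congˡ (*-cong (e zero c) (laplace-cong n λ r s → e (suc r) (punchIn c s)))

  -- Only an element known to be nonzero has an inverse, so the absence of nilpotents comes out
  -- doubly negated.
  reduced : ∀ x → x * x ≈ 0# → ¬ ¬ (x ≈ 0#)
  reduced x x²≈0 x≉0 with Field.inverse F x x≉0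
  ... | y , xy≈1 = 1≉0 (begin
    1#                  ≈⟨ *-identityˡ 1# ⟨
    1# * 1#             ≈⟨ *-cong xy≈1 xy≈1 ⟨
    (x * y) * (x * y)   ≈⟨ solve 2 (λ x y → (x :* y) :* (x :* y) := (x :* x) :* (y :* y)) refl x y ⟩
    (x * x) * (y * y)   ≈⟨ *-congʳ x²≈0 ⟩
    0# * (y * y)        ≈⟨ zeroˡ _ ⟩
    0#                  ∎)

  -- The hypotheses are minors of orders two and three on three indices. Multiplied by α u p, the
  -- cubic relation has the terms α² (p t)(r u) = α² and a multiple of α β = 0.
  square-vanishes : ∀ {α β p r t u} → - (α * β) ≈ 0# → - (p * t) ≈ 1# → - (r * u) ≈ 1# →
    α * r * t + p * β * u ≈ 0# → α * α ≈ 0#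
  square-vanishes {α} {β} {p} {r} {t} {u} αβ pt ru e = begin
    α * α
      ≈⟨ solve 1 (λ a → a :* a := (a :* a) :* (:1 :* :1)) refl α ⟩
    (α * α) * (1# * 1#)
      ≈⟨ *-congˡ (*-cong pt ru) ⟨
    (α * α) * (- (p * t) * - (r * u))
      ≈⟨ solve 6 (λ α β p r t u → (α :* α) :* ((:- (p :* t)) :* (:- (r :* u))) :=
           (α :* u :* p) :* (α :* r :* t :+ p :* β :* u) :+ (u :* u :* p :* p) :* (:- (α :* β))) refl α β p r t u ⟩
    (α * u * p) * (α * r * t + p * β * u) + (u * u * p * p) * - (α * β)
      ≈⟨ +-cong (*-congˡ e) (*-congˡ αβ) ⟩
    (α * u * p) * 0# + (u * u * p * p) * 0#
      ≈⟨ solve 2 (λ a b → a :* :0 :+ b :* :0 := :0) refl _ _ ⟩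
    0# ∎

  -- Of the four terms of (ps - qr)(tz - uw), two are products of pairs of the given minors and
  -- equal 1; the other two are -X and -Y. So X + Y = 1, while XY is the product of all four minors,
  -- that is 1. Then 2X - 1 is a square root of the discriminant.
  minus-three-square : ∀ {p q r s t u w z} → - (p * t) ≈ 1# → - (q * w) ≈ 1# → - (r * u) ≈ 1# → - (s * z) ≈ 1# →
    (p * s - q * r) * (t * z - u * w) ≈ 1# → ∃ λ y → y * y ≈ - (1# + 1# + 1#)
  minus-three-square {p} {q} {r} {s} {t} {u} {w} {z} pt qw ru sz e = (1# + 1#) * X - 1# , (begin
    ((1# + 1#) * X - 1#) * ((1# + 1#) * X - 1#)
      -- X² - X + 1 is written as X (X + Y - 1) + (1 - XY), into which both relations can be
      -- substituted.
      ≈⟨ solve 2 (λ X Y → ((:1 :+ :1) :* X :- :1) :* ((:1 :+ :1) :* X :- :1) :=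
           :- (:1 :+ :1 :+ :1) :+ (:1 :+ :1 :+ :1 :+ :1) :* (X :* ((X :+ Y) :- :1) :+ (:1 :- X :* Y))) refl X Y ⟩
    - (1# + 1# + 1#) + (1# + 1# + 1# + 1#) * (X * ((X + Y) - 1#) + (1# - X * Y))
      ≈⟨ +-congˡ (*-congˡ (+-cong (*-congˡ (+-congʳ X+Y≈1)) (+-congˡ (-‿cong XY≈1)))) ⟩
    - (1# + 1# + 1#) + (1# + 1# + 1# + 1#) * (X * (1# - 1#) + (1# - 1#))
      ≈⟨ solve 1 (λ X → :- (:1 :+ :1 :+ :1) :+ (:1 :+ :1 :+ :1 :+ :1) :* (X :* (:1 :- :1) :+ (:1 :- :1)) :=
           :- (:1 :+ :1 :+ :1)) refl X ⟩
    - (1# + 1# + 1#) ∎)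
    where
    X Y : Carrier
    X = p * s * (u * w)
    Y = q * r * (t * z)
    XY≈1 : X * Y ≈ 1#
    XY≈1 = begin
      X * Y ≈⟨ solve 8 (λ p q r s t u w z → (p :* s :* (u :* w)) :* (q :* r :* (t :* z)) :=
                 ((:- (p :* t)) :* (:- (q :* w))) :* ((:- (r :* u)) :* (:- (s :* z)))) refl p q r s t u w z ⟩
      (- (p * t) * - (q * w)) * (- (r * u) * - (s * z)) ≈⟨ *-cong (*-cong pt qw) (*-cong ru sz) ⟩
      (1# * 1#) * (1# * 1#) ≈⟨ solve 0 ((:1 :* :1) :* (:1 :* :1) := :1) refl ⟩
      1# ∎
    X+Y≈1 : X + Y ≈ 1#
    X+Y≈1 = begin
      X + Y ≈⟨ solve 8 (λ p q r s t u w z → p :* s :* (u :* w) :+ q :* r :* (t :* z) :=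
                 ((:- (p :* t)) :* (:- (s :* z)) :+ (:- (q :* w)) :* (:- (r :* u))) :- (p :* s :- q :* r) :* (t :* z :- u :* w))
                 refl p q r s t u w z ⟩
      (- (p * t) * - (s * z) + - (q * w) * - (r * u)) - (p * s - q * r) * (t * z - u * w)
        ≈⟨ +-cong (+-cong (*-cong pt sz) (*-cong qw ru)) (-‿cong e) ⟩
      (1# * 1# + 1# * 1#) - 1# ≈⟨ solve 0 ((:1 :* :1 :+ :1 :* :1) :- :1 := :1) refl ⟩
      1# ∎

  -- The choices in which f flips basis are the picks whose coordinates form a principal minor.
  basis : Fin 4 → Bool
  basis = true ∷ true ∷ false ∷ false ∷ []

  -- Flipping an odd number of choices makes the number of `true` odd, so the minors of order three
  -- are 0. A minor of order two is 1 if its indices come from different blocks and 0 otherwise, and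
  -- the one of order four is 1.
  grid-impossible : MinusThreeNonResidue F → (g : Fin 4 → Fin 4 → Carrier) →
    (∀ f → laplace 4 (λ i → minorRow 0# 1# g i (f i)) ≈ exactly 4 2 (λ i → basis i xor f i)) → ⊥
  grid-impossible nonresidue g h =
    -- Since the goal is absurdity, the doubly negated equations may be used as equations.
    reduced α αα λ α≈0 → reduced β ββ λ β≈0 → reduced γ γγ λ γ≈0 → reduced δ δδ λ δ≈0 →
    nonresidue (minus-three-square pt qw ru sz (trans (sym (solve 8
      -- With the Greek entries 0, the determinant is the product of the determinants of the two
      -- off-diagonal blocks.
      (λ p q r s t u w z → Syntax.laplace 4 (λ i → minorRow :0 :1 (grid :0 :0 p q :0 r s t u :0 w z :0) i true) :=
        (p :* s :- q :* r) :* (t :* z :- u :* w)) refl p q r s t u w z))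
      (trans (laplace-cong 4 (zeros α≈0 β≈0 γ≈0 δ≈0)) (h (true ∷ true ∷ true ∷ true ∷ [])))))
    where
    i0 i1 i2 i3 : Fin 4
    i0 = zero
    i1 = suc zero
    i2 = suc (suc zero)
    i3 = suc (suc (suc zero))
    α = g i0 i1
    p = g i0 i2
    q = g i0 i3
    β = g i1 i0
    r = g i1 i2
    s = g i1 i3
    t = g i2 i0
    u = g i2 i1
    γ = g i2 i3
    w = g i3 i0
    z = g i3 i1
    δ = g i3 i2
    zeros : α ≈ 0# → β ≈ 0# → γ ≈ 0# → δ ≈ 0# → ∀ i j →
      minorRow 0# 1# (grid 0# 0# p q 0# r s t u 0# w z 0#) i true j ≈ minorRow 0# 1# g i true j
    zeros a b c d zero zero = refl
    zeros a b c d zero (suc zero) = sym a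
    zeros a b c d zero (suc (suc zero)) = refl
    zeros a b c d zero (suc (suc (suc zero))) = refl
    zeros a b c d (suc zero) zero = sym b
    zeros a b c d (suc zero) (suc zero) = refl
    zeros a b c d (suc zero) (suc (suc zero)) = refl
    zeros a b c d (suc zero) (suc (suc (suc zero))) = refl
    zeros a b c d (suc (suc zero)) zero = refl
    zeros a b c d (suc (suc zero)) (suc zero) = refl
    zeros a b c d (suc (suc zero)) (suc (suc zero)) = refl
    zeros a b c d (suc (suc zero)) (suc (suc (suc zero))) = sym c
    zeros a b c d (suc (suc (suc zero))) zero = refl
    zeros a b c d (suc (suc (suc zero))) (suc zero) = refl
    zeros a b c d (suc (suc (suc zero))) (suc (suc zero)) = sym d
    zeros a b c d (suc (suc (suc zero))) (suc (suc (suc zero))) = refl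
    αβ : - (α * β) ≈ 0#
    -- A row that is not flipped is a unit row and never looks at `grid`, so zeros stand in for its
    -- entries here and in the minors below.
    αβ = trans (sym (solve 6 (λ α p q β r s → Syntax.laplace 4 (λ i → minorRow :0 :1 (grid :0 α p q β r s :0 :0 :0 :0 :0 :0) i
           ((true ∷ true ∷ false ∷ false ∷ []) i)) := :- (α :* β)) refl α p q β r s)) (h (true ∷ true ∷ false ∷ false ∷ []))
    pt : - (p * t) ≈ 1#
    pt = trans (sym (solve 6 (λ α p q t u γ → Syntax.laplace 4 (λ i → minorRow :0 :1 (grid :0 α p q :0 :0 :0 t u γ :0 :0 :0) i
           ((true ∷ false ∷ true ∷ false ∷ []) i)) := :- (p :* t)) refl α p q t u γ)) (h (true ∷ false ∷ true ∷ false ∷ []))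
    qw : - (q * w) ≈ 1#
    qw = trans (sym (solve 6 (λ α p q w z δ → Syntax.laplace 4 (λ i → minorRow :0 :1 (grid :0 α p q :0 :0 :0 :0 :0 :0 w z δ) i
           ((true ∷ false ∷ false ∷ true ∷ []) i)) := :- (q :* w)) refl α p q w z δ)) (h (true ∷ false ∷ false ∷ true ∷ []))
    ru : - (r * u) ≈ 1#
    ru = trans (sym (solve 6 (λ β r s t u γ → Syntax.laplace 4 (λ i → minorRow :0 :1 (grid :0 :0 :0 :0 β r s t u γ :0 :0 :0) i
           ((false ∷ true ∷ true ∷ false ∷ []) i)) := :- (r :* u)) refl β r s t u γ)) (h (false ∷ true ∷ true ∷ false ∷ []))
    sz : - (s * z) ≈ 1#
    sz = trans (sym (solve 6 (λ β r s w z δ → Syntax.laplace 4 (λ i → minorRow :0 :1 (grid :0 :0 :0 :0 β r s :0 :0 :0 w z δ) i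
           ((false ∷ true ∷ false ∷ true ∷ []) i)) := :- (s :* z)) refl β r s w z δ)) (h (false ∷ true ∷ false ∷ true ∷ []))
    γδ : - (γ * δ) ≈ 0#
    γδ = trans (sym (solve 6 (λ t u γ w z δ → Syntax.laplace 4 (λ i → minorRow :0 :1 (grid :0 :0 :0 :0 :0 :0 :0 t u γ w z δ) i
           ((false ∷ false ∷ true ∷ true ∷ []) i)) := :- (γ :* δ)) refl t u γ w z δ)) (h (false ∷ false ∷ true ∷ true ∷ []))
    αrt : α * r * t + p * β * u ≈ 0#
    αrt = trans (sym (solve 9 (λ α p q β r s t u γ → Syntax.laplace 4 (λ i → minorRow :0 :1 (grid :0 α p q β r s t u γ :0 :0 :0) i
           ((true ∷ true ∷ true ∷ false ∷ []) i)) := α :* r :* t :+ p :* β :* u) refl α p q β r s t u γ)) (h (true ∷ true ∷ true ∷ false ∷ []))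
    γwp : γ * w * p + t * δ * q ≈ 0#
    γwp = trans (sym (solve 9 (λ α p q t u γ w z δ → Syntax.laplace 4 (λ i → minorRow :0 :1 (grid :0 α p q :0 :0 :0 t u γ w z δ) i
           ((true ∷ false ∷ true ∷ true ∷ []) i)) := γ :* w :* p :+ t :* δ :* q) refl α p q t u γ w z δ)) (h (true ∷ false ∷ true ∷ true ∷ []))
    flip : ∀ {x y k} → - (x * y) ≈ k → - (y * x) ≈ k
    flip = trans (-‿cong (*-comm _ _))
    -- The four uses take the indices 0, 1, 2, then 1, 0, 2, then 2, 3, 0, and finally 3, 2, 0.
    αα = square-vanishes αβ pt ru αrt
    ββ = square-vanishes (flip αβ) ru pt (trans (solve 6 (λ α r t p β u → β :* p :* u :+ r :* α :* t := α :* r :* t :+ p :* β :* u) refl α r t p β u) αrt)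
    γγ = square-vanishes γδ (flip pt) (flip qw) γwp
    δδ = square-vanishes (flip γδ) (flip qw) (flip pt) (trans (solve 6 (λ γ w p t δ q → δ :* t :* q :+ w :* γ :* p := γ :* w :* p :+ t :* δ :* q) refl γ w p t δ q) γwp)

-- Reduction of symmetric values to four vectors

module SymmetricForms {c ℓ} (F : Field c ℓ) where
  open Field F hiding (zero)
  open IntegerSolver commRing
  open MultilinearForms commRing
  open ExchangeForms commRing using (Exchange; exchange-laplace; fix-exchange)
  open FourForms F
  open Laplace _+_ _*_ -_ 0# 1# using (laplace)
  open Relation.Binary.Reasoning.Setoid setoid

  -- `o` makes the opposite choice to `b` everywhere, so `pick b o f` flips the choices marked by
  -- `f`. In coordinates with respect to `b`, an unflipped vector is a unit row and a flipped one a
  -- row of `g`.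
  four-form-impossible : MinusThreeNonResidue F → ∀ {k} {ω : (Fin 4 → V k) → Carrier} →
    Alternating ω → Exchange ω → ∀ a e → (∀ T → ω (pick a e T) ≈ exactly 4 2 T) → ⊥
  four-form-impossible nonresidue {k} {ω} alt ex a e h = grid-impossible nonresidue g λ f → begin
    laplace 4 (λ i → minorRow 0# 1# g i (f i))                         ≈⟨ laplace-cong 4 (λ i j → entry i j (f i)) ⟨
    laplace 4 (λ i j → ω (updateAt b j (const (pick b o f i))))        ≈⟨ exchange-laplace alt ex b (h basis) (pick b o f) ⟨
    ω (pick b o f)                                                     ≈⟨ cong (λ i → flipped i (f i)) ⟩
    ω (pick a e (λ i → basis i xor f i))                               ≈⟨ h _ ⟩
    exactly 4 2 (λ i → basis i xor f i)                                ∎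
    where
    open Alternating alt
    b o : Fin 4 → V k
    b = pick a e basis
    o = pick a e (not ∘ basis)
    g : Fin 4 → Fin 4 → Carrier
    g i j = ω (updateAt b j (const (o i)))
    flipped : ∀ i t → (if t then o i else b i) ≋ (if basis i xor t then e i else a i)
    flipped i t with basis i
    flipped i true  | true  = λ r → refl
    flipped i false | true  = λ r → refl
    flipped i true  | false = λ r → refl
    flipped i false | false = λ r → refl
    -- One flip leaves one or three of the `e`, never two.
    diagonal : ∀ i → g i i ≈ 0#
    diagonal zero = trans (cong λ { zero r → refl ; (suc zero) r → refl ; (suc (suc zero)) r → refl ; (suc (suc (suc zero))) r → refl })
      (h (false ∷ true ∷ false ∷ false ∷ []))
    diagonal (suc zero) = trans (cong λ { zero r → refl ; (suc zero) r → refl ; (suc (suc zero)) r → refl ; (suc (suc (suc zero))) r → refl })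
      (h (true ∷ false ∷ false ∷ false ∷ []))
    diagonal (suc (suc zero)) = trans (cong λ { zero r → refl ; (suc zero) r → refl ; (suc (suc zero)) r → refl ; (suc (suc (suc zero))) r → refl })
      (h (true ∷ true ∷ true ∷ false ∷ []))
    diagonal (suc (suc (suc zero))) = trans (cong λ { zero r → refl ; (suc zero) r → refl ; (suc (suc zero)) r → refl ; (suc (suc (suc zero))) r → refl })
      (h (true ∷ true ∷ false ∷ true ∷ []))
    entry : ∀ i j t → ω (updateAt b j (const (if t then o i else b i))) ≈ minorRow 0# 1# g i t j
    entry i j t with i Fin.≟ j
    entry i j true  | yes ≡.refl = diagonal i
    entry i j false | yes ≡.refl = trans (cong λ s → ≡⇒≋ (updateAt-id-local i b ≡.refl s)) (h basis)
    entry i j true  | no i≢j = refl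
    entry i j false | no i≢j = alternating i≢j (≡⇒≋ (≡.trans (updateAt-minimal i j b i≢j) (≡.sym (updateAt-updates j b))))

  esp : ∀ n → ℕ → V n → Carrier
  esp n       zero    x = 1#
  esp zero    (suc d) x = 0#
  esp (suc n) (suc d) x = x zero * esp n d (x ∘ suc) + esp n (suc d) (x ∘ suc)

  esp-head-0 : ∀ n d x → esp (suc n) d (0# ∷ x) ≈ esp n d x
  esp-head-0 n zero x = refl
  esp-head-0 n (suc d) x = solve 2 (λ p q → :0 :* p :+ q := q) refl (esp n d x) (esp n (suc d) x)

  esp-head-1 : ∀ n d x → esp (suc n) (suc d) (1# ∷ x) - esp n (suc d) x ≈ esp n d x
  esp-head-1 n d x = solve 2 (λ p q → (:1 :* p :+ q) :- q := p) refl (esp n d x) (esp n (suc d) x)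

  line : ∀ {k n} → (Fin n → V k) → (Fin n → V k) → V n → Fin n → V k
  line a e x i = a i +[ x i ] e i

  module _ {k n} {ω : (Fin (suc n) → V k) → Carrier} (ml : Multilinear ω) (a e : Fin (suc n) → V k) where
    open Multilinear ml

    private
      ω-line : ∀ t x → ω (line a e (t ∷ x)) ≈ ω (a zero ∷ line (a ∘ suc) (e ∘ suc) x) + t * ω (e zero ∷ line (a ∘ suc) (e ∘ suc) x)
      ω-line t x = trans (cong λ { zero r → refl ; (suc i) r → refl })
        (Linear.linear (head-linear ml (line (a ∘ suc) (e ∘ suc) x)) (a zero) t (e zero))

    constant-part : ∀ x → ω (a zero ∷ line (a ∘ suc) (e ∘ suc) x) ≈ ω (line a e (0# ∷ x))
    constant-part x = begin
      ω₀                   ≈⟨ solve 2 (λ p q → p := p :+ :0 :* q) refl ω₀ ω₁ ⟩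
      ω₀ + 0# * ω₁         ≈⟨ ω-line 0# x ⟨
      ω (line a e (0# ∷ x)) ∎
      where
      ω₀ = ω (a zero ∷ line (a ∘ suc) (e ∘ suc) x)
      ω₁ = ω (e zero ∷ line (a ∘ suc) (e ∘ suc) x)

    -- An affine function of one variable is determined by its values at 0 and 1, over any field.
    slope : ∀ x → ω (e zero ∷ line (a ∘ suc) (e ∘ suc) x) ≈ ω (line a e (1# ∷ x)) - ω (line a e (0# ∷ x))
    slope x = begin
      ω₁                                            ≈⟨ solve 2 (λ p q → q := (p :+ :1 :* q) :- p) refl ω₀ ω₁ ⟩
      (ω₀ + 1# * ω₁) - ω₀                           ≈⟨ +-cong (sym (ω-line 1# x)) (-‿cong (constant-part x)) ⟩
      ω (line a e (1# ∷ x)) - ω (line a e (0# ∷ x)) ∎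
      where
      ω₀ = ω (a zero ∷ line (a ∘ suc) (e ∘ suc) x)
      ω₁ = ω (e zero ∷ line (a ∘ suc) (e ∘ suc) x)

    -- Choosing `a zero` sets the first variable to 0, choosing `e zero` takes the coefficient of
    -- that variable. Either way an elementary symmetric polynomial in the others remains.
    fix-constant : ∀ d → (∀ x → ω (line a e x) ≈ esp (suc n) d x) →
      ∀ x → ω (a zero ∷ line (a ∘ suc) (e ∘ suc) x) ≈ esp n d x
    fix-constant d h x = trans (constant-part x) (trans (h _) (esp-head-0 n d x))

    fix-slope : ∀ d → (∀ x → ω (line a e x) ≈ esp (suc n) (suc d) x) →
      ∀ x → ω (e zero ∷ line (a ∘ suc) (e ∘ suc) x) ≈ esp n d x
    fix-slope d h x = trans (slope x)
      (trans (+-cong (h _) (-‿cong (trans (h _) (esp-head-0 n (suc d) x)))) (esp-head-1 n d x))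

    pick-head : ∀ T → ω (pick a e T) ≈ ω ((if T zero then e zero else a zero) ∷ pick (a ∘ suc) (e ∘ suc) (T ∘ suc))
    pick-head T = cong λ { zero r → refl ; (suc i) r → refl }

  -- Serves choices with too many `e`: once the degree is 0 the values are constantly 1, the next
  -- slope is 0, and it stays 0 under all further choices.
  zero-on-picks : ∀ {k n} {ω : (Fin n → V k) → Carrier} → Multilinear ω → ∀ a e →
    (∀ x → ω (line a e x) ≈ 0#) → ∀ T → ω (pick a e T) ≈ 0#
  zero-on-picks {n = zero} ml a e h T = trans (Multilinear.cong ml λ ()) (h λ ())
  zero-on-picks {n = suc n} {ω} ml a e h T with T zero | pick-head ml a e T
  ... | true  | p = trans p (zero-on-picks (fix-multilinear ml (e zero)) (a ∘ suc) (e ∘ suc)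
                      (λ x → trans (slope ml a e x) (trans (+-cong (h _) (-‿cong (h _))) (-‿inverseʳ 0#))) (T ∘ suc))
  ... | false | p = trans p (zero-on-picks (fix-multilinear ml (a zero)) (a ∘ suc) (e ∘ suc)
                      (λ x → trans (constant-part ml a e x) (h _)) (T ∘ suc))

  esp-on-picks : ∀ {k n} {ω : (Fin n → V k) → Carrier} → Multilinear ω → ∀ a e d →
    (∀ x → ω (line a e x) ≈ esp n d x) → ∀ T → ω (pick a e T) ≈ exactly n d T
  esp-on-picks {n = zero} ml a e zero h T = trans (Multilinear.cong ml λ ()) (h λ ())
  esp-on-picks {n = zero} ml a e (suc d) h T = trans (Multilinear.cong ml λ ()) (h λ ())
  esp-on-picks {n = suc n} ml a e zero h T with T zero | pick-head ml a e T
  ... | true  | p = trans p (zero-on-picks (fix-multilinear ml (e zero)) (a ∘ suc) (e ∘ suc)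
                      (λ x → trans (slope ml a e x) (trans (+-cong (h _) (-‿cong (h _))) (-‿inverseʳ 1#))) (T ∘ suc))
  ... | false | p = trans p (esp-on-picks (fix-multilinear ml (a zero)) (a ∘ suc) (e ∘ suc) zero
                      (fix-constant ml a e zero h) (T ∘ suc))
  esp-on-picks {n = suc n} ml a e (suc d) h T with T zero | pick-head ml a e T
  ... | true  | p = trans p (esp-on-picks (fix-multilinear ml (e zero)) (a ∘ suc) (e ∘ suc) d
                      (fix-slope ml a e d h) (T ∘ suc))
  ... | false | p = trans p (esp-on-picks (fix-multilinear ml (a zero)) (a ∘ suc) (e ∘ suc) (suc d)
                      (fix-constant ml a e (suc d) h) (T ∘ suc))

  -- `i` counts the slots to be frozen at `e`, each of which lowers the degree, and `j` those to be
  -- frozen at `a`, which keep it.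
  symmetric-form-impossible : MinusThreeNonResidue F → ∀ i j {k} {ω : (Fin (4 ℕ.+ (i ℕ.+ j)) → V k) → Carrier} →
    Alternating ω → Exchange ω → ∀ a e → (∀ x → ω (line a e x) ≈ esp (4 ℕ.+ (i ℕ.+ j)) (2 ℕ.+ i) x) → ⊥
  symmetric-form-impossible nonresidue zero zero alt ex a e h =
    four-form-impossible nonresidue alt ex a e (esp-on-picks (Alternating.multilinear alt) a e 2 h)
  symmetric-form-impossible nonresidue zero (suc j) alt ex a e h =
    symmetric-form-impossible nonresidue zero j (fix-alternating alt (a zero)) (fix-exchange alt ex (a zero))
      (a ∘ suc) (e ∘ suc) (fix-constant (Alternating.multilinear alt) a e 2 h)
  symmetric-form-impossible nonresidue (suc i) j alt ex a e h =
    symmetric-form-impossible nonresidue i j (fix-alternating alt (e zero)) (fix-exchange alt ex (e zero))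
      (a ∘ suc) (e ∘ suc) (fix-slope (Alternating.multilinear alt) a e (2 ℕ.+ i) h)

-- Evaluation of formal polynomials

module Monomials {c ℓ} (F : Field c ℓ) where
  open Field F hiding (zero)
  open IntegerSolver commRing
  open Algebra.Properties.Semiring.Exp semiring using (_^_; ^-homo-*)

  monomial : ∀ {n} → Monomial F n → (Fin n → Carrier) → Carrier
  monomial Vec.[]       x = 1#
  monomial (e Vec.∷ es) x = x zero ^ e * monomial es (x ∘ suc)

  monomial-+ : ∀ {n} (e f : Monomial F n) x → monomial (Vec.zipWith ℕ._+_ e f) x ≈ monomial e x * monomial f x
  monomial-+ Vec.[] Vec.[] x = sym (*-identityʳ 1#)
  monomial-+ (e Vec.∷ es) (f Vec.∷ fs) x = trans (*-cong (^-homo-* (x zero) e f) (monomial-+ es fs (x ∘ suc)))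
    (solve 4 (λ a b c d → (a :* b) :* (c :* d) := (a :* c) :* (b :* d)) refl _ _ _ _)

  monomial-0 : ∀ {n} (x : Fin n → Carrier) → monomial (Vec.replicate n 0) x ≈ 1#
  monomial-0 {zero} x = refl
  monomial-0 {suc n} x = trans (*-identityˡ _) (monomial-0 (x ∘ suc))

  monomial-1 : ∀ {n} (x : Fin n → Carrier) i → monomial (Vec.updateAt (Vec.replicate n 0) i (λ _ → 1)) x ≈ x i
  monomial-1 x zero = trans (*-congˡ (monomial-0 (x ∘ suc))) (trans (*-identityʳ _) (*-identityʳ _))
  monomial-1 x (suc i) = trans (*-identityˡ _) (monomial-1 (x ∘ suc) i)

module Evaluation {c ℓ} (F : Field c ℓ) {n : ℕ} (x : Fin n → Field.Carrier F) where
  open Field F hiding (zero)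
  open IntegerSolver commRing
  open Monomials F
  open Relation.Binary.Reasoning.Setoid setoid

  eval : Poly F n → Carrier
  eval List.[]             = 0#
  eval ((a , e) List.∷ ts) = a * monomial e x + eval ts

  eval-⊕ : ∀ p q → eval (_⊕_ F p q) ≈ eval p + eval q
  eval-⊕ List.[] q = sym (+-identityˡ _)
  eval-⊕ ((a , e) List.∷ ts) q = trans (+-congˡ (eval-⊕ ts q)) (sym (+-assoc _ _ _))

  eval-neg : ∀ p → eval (neg F p) ≈ - eval p
  eval-neg List.[] = solve 0 (:0 := :- :0) refl
  eval-neg ((a , e) List.∷ ts) = trans (+-congˡ (eval-neg ts))
    (solve 3 (λ a m t → (:- a) :* m :+ (:- t) := :- (a :* m :+ t)) refl a (monomial e x) (eval ts))

  eval-const : ∀ a → eval (Defs.const F a) ≈ a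
  eval-const a = trans (+-identityʳ _) (trans (*-congˡ (monomial-0 x)) (*-identityʳ a))

  eval-var : ∀ i → eval (var F i) ≈ x i
  eval-var i = trans (+-identityʳ _) (trans (*-identityˡ _) (monomial-1 x i))

  mutual
    -- The anonymous function by which Defs multiplies two terms; the equation below determines it.
    termProduct : (p q : Poly F n) → Carrier × Monomial F n → Carrier × Monomial F n → Carrier × Monomial F n
    termProduct = _

    ⊗-concatMap : ∀ p q → _⊗_ F p q ≡ List.concatMap (λ t → List.map (termProduct p q t) q) p
    ⊗-concatMap p q = ≡.refl

  eval-⊗ : ∀ p q → eval (_⊗_ F p q) ≈ eval p * eval q
  eval-⊗ p q = go (termProduct p q) (λ _ _ → ≡.refl) p
    where
    module _ (g : Carrier × Monomial F n → Carrier × Monomial F n → Carrier × Monomial F n)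
             (g-product : ∀ t u → g t u ≡ (proj₁ t * proj₁ u , Vec.zipWith ℕ._+_ (proj₂ t) (proj₂ u))) where
      row : ∀ a e q → eval (List.map (g (a , e)) q) ≈ (a * monomial e x) * eval q
      row a e List.[] = sym (zeroʳ _)
      row a e ((b , f) List.∷ q) rewrite g-product (a , e) (b , f) =
        trans (+-cong (*-congˡ (monomial-+ e f x)) (row a e q))
          (solve 5 (λ a m b m' t → (a :* b) :* (m :* m') :+ (a :* m) :* t := (a :* m) :* (b :* m' :+ t)) refl
            a (monomial e x) b (monomial f x) (eval q))
      go : ∀ p → eval (List.concatMap (λ t → List.map (g t) q) p) ≈ eval p * eval q
      go List.[] = sym (zeroˡ _)
      go ((a , e) List.∷ p) = trans (eval-⊕ (List.map (g (a , e)) q) _)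
        (trans (+-cong (row a e q) (go p)) (sym (distribʳ _ _ _)))

  remove : Monomial F n → Poly F n → Poly F n
  remove m List.[] = List.[]
  remove m ((a , e) List.∷ ts) with ≡-dec ℕ._≟_ e m
  ... | yes _ = remove m ts
  ... | no _  = (a , e) List.∷ remove m ts

  length-remove : ∀ m p → List.length (remove m p) ℕ.≤ List.length p
  length-remove m List.[] = ℕ.z≤n
  length-remove m ((a , e) List.∷ ts) with ≡-dec ℕ._≟_ e m
  ... | yes _ = ℕ.m≤n⇒m≤1+n (length-remove m ts)
  ... | no _  = ℕ.s≤s (length-remove m ts)

  eval-remove : ∀ m p → eval p ≈ coeff F p m * monomial m x + eval (remove m p)
  eval-remove m List.[] = solve 1 (λ a → :0 := :0 :* a :+ :0) refl (monomial m x)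
  eval-remove m ((a , e) List.∷ ts) with ≡-dec ℕ._≟_ e m
  ... | yes ≡.refl = trans (+-congˡ (eval-remove m ts))
    (solve 4 (λ a m c t → a :* m :+ (c :* m :+ t) := (a :+ c) :* m :+ t) refl a (monomial m x) _ _)
  ... | no _ = trans (+-congˡ (eval-remove m ts))
    (solve 4 (λ a m c t → a :+ (c :* m :+ t) := c :* m :+ (a :+ t)) refl (a * monomial e x) (monomial m x) _ _)

  coeff-remove : ∀ m p m' → (coeff F (remove m p) m' ≈ 0#) ⊎ (coeff F (remove m p) m' ≈ coeff F p m')
  coeff-remove m p m' with ≡-dec ℕ._≟_ m m'
  ... | yes ≡.refl = inj₁ (removed p)
    where
    removed : ∀ p → coeff F (remove m p) m ≈ 0#
    removed List.[] = refl
    removed ((a , e) List.∷ ts) with ≡-dec ℕ._≟_ e m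
    ... | yes _ = removed ts
    ... | no e≢m with ≡-dec ℕ._≟_ e m
    ... | yes e≡m = contradiction e≡m e≢m
    ... | no _ = removed ts
  ... | no m≢m' = inj₂ (kept p)
    where
    kept : ∀ p → coeff F (remove m p) m' ≈ coeff F p m'
    kept List.[] = refl
    kept ((a , e) List.∷ ts) with ≡-dec ℕ._≟_ e m
    kept ((a , e) List.∷ ts) | yes ≡.refl with ≡-dec ℕ._≟_ e m'
    ... | yes e≡m' = contradiction e≡m' m≢m'
    ... | no _ = kept ts
    kept ((a , e) List.∷ ts) | no _ with ≡-dec ℕ._≟_ e m'
    ... | yes _ = +-congˡ (kept ts)
    ... | no _ = kept ts

  -- Terms with the same exponent may be scattered over the list and cancel only together. All terms
  -- sharing the first exponent are removed at once, and a bound on the length drives the induction.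
  eval-zero : ∀ p → (∀ m → coeff F p m ≈ 0#) → eval p ≈ 0#
  eval-zero p = go (List.length p) p ℕ.≤-refl
    where
    go : ∀ k p → List.length p ℕ.≤ k → (∀ m → coeff F p m ≈ 0#) → eval p ≈ 0#
    go k List.[] _ z = refl
    go (suc k) p@((a , e) List.∷ ts) (ℕ.s≤s len) z = begin
      eval p                                              ≈⟨ eval-remove e p ⟩
      coeff F p e * monomial e x + eval (remove e p)      ≈⟨ +-cong (*-congʳ (z e)) (go k (remove e p) shorter z') ⟩
      0# * monomial e x + 0#                              ≈⟨ solve 1 (λ a → :0 :* a :+ :0 := :0) refl (monomial e x) ⟩
      0#                                                  ∎
      where
      shorter : List.length (remove e p) ℕ.≤ k
      shorter with ≡-dec ℕ._≟_ e e
      ... | yes _ = ℕ.≤-trans (length-remove e ts) len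
      ... | no e≢e = contradiction ≡.refl e≢e
      z' : ∀ m → coeff F (remove e p) m ≈ 0#
      z' m with coeff-remove e p m
      ... | inj₁ eq = eq
      ... | inj₂ eq = trans eq (z m)

  coeff-⊕ : ∀ (p q : Poly F n) m → coeff F (_⊕_ F p q) m ≈ coeff F p m + coeff F q m
  coeff-⊕ List.[] q m = sym (+-identityˡ _)
  coeff-⊕ ((a , e) List.∷ ts) q m with ≡-dec ℕ._≟_ e m
  ... | yes _ = trans (+-congˡ (coeff-⊕ ts q m)) (sym (+-assoc _ _ _))
  ... | no _  = coeff-⊕ ts q m

  coeff-neg : ∀ (p : Poly F n) m → coeff F (neg F p) m ≈ - coeff F p m
  coeff-neg List.[] m = solve 0 (:0 := :- :0) refl
  coeff-neg ((a , e) List.∷ ts) m with ≡-dec ℕ._≟_ e m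
  ... | yes _ = trans (+-congˡ (coeff-neg ts m)) (solve 2 (λ a b → (:- a) :+ (:- b) := :- (a :+ b)) refl a _)
  ... | no _  = coeff-neg ts m

  eval-≃ : ∀ {p q} → _≃_ F p q → eval p ≈ eval q
  eval-≃ {p} {q} p≃q = begin
    eval p                        ≈⟨ solve 2 (λ a b → a := (a :- b) :+ b) refl (eval p) (eval q) ⟩
    (eval p - eval q) + eval q    ≈⟨ +-congʳ (+-congˡ (eval-neg q)) ⟨
    (eval p + eval (neg F q)) + eval q  ≈⟨ +-congʳ (eval-⊕ p (neg F q)) ⟨
    eval (_⊕_ F p (neg F q)) + eval q   ≈⟨ +-congʳ (eval-zero (_⊕_ F p (neg F q)) difference) ⟩
    0# + eval q                   ≈⟨ +-identityˡ _ ⟩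
    eval q                        ∎
    where
    difference : ∀ m → coeff F (_⊕_ F p (neg F q)) m ≈ 0#
    difference m = trans (coeff-⊕ p (neg F q) m) (trans (+-cong (p≃q m) (coeff-neg q m)) (-‿inverseʳ _))

-- Determinants and symmetric polynomials as functions

module ReadOnce {c ℓ} (F : Field c ℓ) where
  open Field F hiding (zero)
  open IntegerSolver commRing
  open MultilinearForms commRing
  open Determinants commRing
  open ExchangeForms commRing using (module Overwrite; overwrite-exchange)
  open SymmetricForms F
  open Algebra.Properties.Semiring.Sum semiring using (sum; sum-cong-≋; *-distribˡ-sum)
  open Relation.Binary.Reasoning.Setoid setoid
  open Evaluation F

  private
    -- Its first row starts with two zero polynomials, which makes the first two terms of the
    -- Laplace expansion vanish definitionally and exposes the local function of Defs.det.
    twoZeros : ∀ {n k} → (Fin (2 ℕ.+ k) → Fin (2 ℕ.+ k) → Poly F n) → Fin (2 ℕ.+ k) → Fin (2 ℕ.+ k) → Poly F n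
    twoZeros A zero    zero       = List.[]
    twoZeros A zero    (suc zero) = List.[]
    twoZeros A i       j          = A i j

    mutual
      expansion : ∀ {n} (k : ℕ) → (Fin (suc k) → Fin (suc k) → Poly F n) →
                  (m : ℕ) → (Fin m → Fin (suc k)) → Bool → Poly F n
      expansion = _

      det-expansion : ∀ {n} k (A : Fin (2 ℕ.+ k) → Fin (2 ℕ.+ k) → Poly F n) →
        Defs.det F (2 ℕ.+ k) (twoZeros A) ≡ expansion (suc k) (twoZeros A) k (λ j → suc (suc j)) true
      det-expansion k A with suc k | twoZeros A | (λ (j : Fin k) → Fin.suc {suc k} (suc j)) | true
      ... | _ | _ | _ | _ = ≡.refl

  -- Both determinants expand along the first row and differ only in the order of the indices, so no
  -- invariance under transposition is involved. The boolean of the formal expansion becomes a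
  -- common sign, which `expand` tracks for every tail of the sum.
  eval-det : ∀ {n} (x : V n) k (A : Fin k → Fin k → Poly F n) →
    eval x (Defs.det F k A) ≈ det k (λ s r → eval x (A r s))
  eval-det x zero A = eval-const x 1#
  eval-det {n} x (suc k) A = trans (expand (suc k) (λ j → j) true) (*-identityˡ _)
    where
    signed : Bool → Carrier
    signed s = if s then 1# else - 1#
    minor : Fin (suc k) → Fin k → Fin k → Poly F n
    minor j r s = A (suc r) (punchIn j s)
    term : Fin (suc k) → Carrier
    term j = eval x (A zero j) * det k (λ s r → eval x (minor j r s))
    eval-term : ∀ j → eval x (_⊗_ F (A zero j) (Defs.det F k (minor j))) ≈ term j
    eval-term j = trans (eval-⊗ x (A zero j) _) (*-congˡ (eval-det x k (minor j)))
    tail-sum : ∀ {m} → (Fin (suc m) → Fin (suc k)) → Carrier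
    tail-sum col = sum λ j → sg j * term (col (suc j))
    alternating-sum : ∀ {m} (col : Fin (suc m) → Fin (suc k)) →
      sum (λ j → sg j * term (col j)) ≈ term (col zero) - tail-sum col
    alternating-sum col = +-cong (*-identityˡ _) (begin
      sum (λ j → - sg j * term (col (suc j)))              ≈⟨ sum-cong-≋ (λ j → solve 2 (λ g a → (:- g) :* a := (:- :1) :* (g :* a)) refl (sg j) (term (col (suc j)))) ⟩
      sum (λ j → - 1# * (sg j * term (col (suc j))))       ≈⟨ *-distribˡ-sum (- 1#) (λ j → sg j * term (col (suc j))) ⟨
      - 1# * tail-sum col                                  ≈⟨ solve 1 (λ a → (:- :1) :* a := :- a) refl (tail-sum col) ⟩
      - tail-sum col                                       ∎)
    expand : ∀ m (col : Fin m → Fin (suc k)) s →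
      eval x (expansion k A m col s) ≈ signed s * sum (λ j → sg j * term (col j))
    expand zero col s = sym (zeroʳ _)
    expand (suc m) col true = begin
      eval x (expansion k A (suc m) col true)
        ≈⟨ eval-⊕ x (_⊗_ F (A zero (col zero)) (Defs.det F k (minor (col zero)))) (expansion k A m (λ j → col (suc j)) false) ⟩
      _ + eval x (expansion k A m (λ j → col (suc j)) false)
        ≈⟨ +-cong (eval-term (col zero)) (expand m (λ j → col (suc j)) false) ⟩
      term (col zero) + - 1# * tail-sum col
        ≈⟨ solve 2 (λ a b → a :+ (:- :1) :* b := :1 :* (a :- b)) refl (term (col zero)) (tail-sum col) ⟩
      1# * (term (col zero) - tail-sum col)
        ≈⟨ *-congˡ (alternating-sum col) ⟨
      1# * sum (λ j → sg j * term (col j)) ∎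
    expand (suc m) col false = begin
      eval x (expansion k A (suc m) col false)
        ≈⟨ eval-⊕ x (neg F (_⊗_ F (A zero (col zero)) (Defs.det F k (minor (col zero))))) (expansion k A m (λ j → col (suc j)) true) ⟩
      _ + eval x (expansion k A m (λ j → col (suc j)) true)
        ≈⟨ +-cong (trans (eval-neg x (_⊗_ F (A zero (col zero)) (Defs.det F k (minor (col zero))))) (-‿cong (eval-term (col zero))))
             (expand m (λ j → col (suc j)) true) ⟩
      - term (col zero) + 1# * tail-sum col
        ≈⟨ solve 2 (λ a b → (:- a) :+ :1 :* b := (:- :1) :* (a :- b)) refl (term (col zero)) (tail-sum col) ⟩
      - 1# * (term (col zero) - tail-sum col)
        ≈⟨ *-congˡ (alternating-sum col) ⟨
      - 1# * sum (λ j → sg j * term (col j)) ∎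

  -- For L the list of all subsets of Fin n, this is the polynomial S F n d.
  subsetSum : ∀ {n} → List (Subset n) → ℕ → Poly F n
  subsetSum L d = List.map (λ A → (1# , Vec.map (λ b → if b then 1 else 0) A)) (List.filter (λ A → ∣ A ∣ ℕ.≟ d) L)

  eval-subsetSum-++ : ∀ {n} (x : V n) L L' d →
    eval x (subsetSum (L List.++ L') d) ≈ eval x (subsetSum L d) + eval x (subsetSum L' d)
  eval-subsetSum-++ x List.[] L' d = sym (+-identityˡ _)
  eval-subsetSum-++ x (A List.∷ L) L' d with ∣ A ∣ ℕ.≡ᵇ d
  ... | true  = trans (+-congˡ (eval-subsetSum-++ x L L' d)) (sym (+-assoc _ _ _))
  ... | false = eval-subsetSum-++ x L L' d

  eval-subsetSum-out : ∀ {n} (x : V (suc n)) L d →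
    eval x (subsetSum (List.map (false Vec.∷_) L) d) ≈ eval (x ∘ suc) (subsetSum L d)
  eval-subsetSum-out x List.[] d = refl
  eval-subsetSum-out x (A List.∷ L) d with ∣ A ∣ ℕ.≡ᵇ d
  ... | true  = +-cong (*-congˡ (*-identityˡ _)) (eval-subsetSum-out x L d)
  ... | false = eval-subsetSum-out x L d

  eval-subsetSum-in-zero : ∀ {n} (x : V (suc n)) L → eval x (subsetSum (List.map (true Vec.∷_) L) 0) ≈ 0#
  eval-subsetSum-in-zero x List.[] = refl
  eval-subsetSum-in-zero x (A List.∷ L) = eval-subsetSum-in-zero x L

  eval-subsetSum-in : ∀ {n} (x : V (suc n)) L d →
    eval x (subsetSum (List.map (true Vec.∷_) L) (suc d)) ≈ x zero * eval (x ∘ suc) (subsetSum L d)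
  eval-subsetSum-in x List.[] d = sym (zeroʳ _)
  -- The test of `true ∷ A` against `suc d` reduces to this one, so a single case distinction
  -- settles both filters.
  eval-subsetSum-in x (A List.∷ L) d with ∣ A ∣ ℕ.≡ᵇ d
  ... | true  = trans (+-congˡ (eval-subsetSum-in x L d))
    (solve 3 (λ t m s → :1 :* ((t :* :1) :* m) :+ t :* s := t :* (:1 :* m :+ s)) refl (x zero) _ _)
  ... | false = eval-subsetSum-in x L d

  eval-S : ∀ n d x → eval x (S F n d) ≈ esp n d x
  eval-S zero zero x = solve 0 (:1 :* :1 :+ :0 := :1) refl
  eval-S zero (suc d) x = refl
  eval-S (suc n) zero x = begin
    eval x (S F (suc n) 0)                 ≈⟨ eval-subsetSum-++ x (List.map (true Vec.∷_) (allSubsets F n)) _ 0 ⟩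
    _ + eval x (subsetSum (List.map (false Vec.∷_) (allSubsets F n)) 0)
      ≈⟨ +-cong (eval-subsetSum-in-zero x (allSubsets F n)) (eval-subsetSum-out x (allSubsets F n) 0) ⟩
    0# + eval (x ∘ suc) (S F n 0)          ≈⟨ +-identityˡ _ ⟩
    eval (x ∘ suc) (S F n 0)               ≈⟨ eval-S n 0 (x ∘ suc) ⟩
    1#                                     ∎
  eval-S (suc n) (suc d) x = begin
    eval x (S F (suc n) (suc d))           ≈⟨ eval-subsetSum-++ x (List.map (true Vec.∷_) (allSubsets F n)) _ (suc d) ⟩
    _ + eval x (subsetSum (List.map (false Vec.∷_) (allSubsets F n)) (suc d))
      ≈⟨ +-cong (eval-subsetSum-in x (allSubsets F n) d) (eval-subsetSum-out x (allSubsets F n) (suc d)) ⟩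
    x zero * eval (x ∘ suc) (S F n d) + eval (x ∘ suc) (S F n (suc d))
      ≈⟨ +-cong (*-congˡ (eval-S n d (x ∘ suc))) (eval-S n (suc d) (x ∘ suc)) ⟩
    esp (suc n) (suc d) x                  ∎

  -- Finite differences of symmetric polynomials

  infixl 5 _[_≔_]
  _[_≔_] : ∀ {n} → V n → Fin n → Carrier → V n
  x [ i ≔ a ] = updateAt x i (const a)

  -- Nonvanishing as a function, which over a finite field is more than having a nonzero
  -- coefficient. Differences between 1 and 0 in the leading variables lower the degree to the
  -- constant 1.
  esp-nonzero : ∀ n d → d ℕ.≤ n → ¬ (∀ x → esp n d x ≈ 0#)
  esp-nonzero n zero _ h = 1≉0 (h (const 0#))
  esp-nonzero (suc n) (suc d) (ℕ.s≤s d≤n) h = esp-nonzero n d d≤n λ x → begin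
    esp n d x
      ≈⟨ solve 2 (λ p q → p := (:1 :* p :+ q) :- (:0 :* p :+ q)) refl (esp n d x) (esp n (suc d) x) ⟩
    esp (suc n) (suc d) (1# ∷ x) - esp (suc n) (suc d) (0# ∷ x)
      ≈⟨ +-cong (h (1# ∷ x)) (-‿cong (h (0# ∷ x))) ⟩
    0# - 0#
      ≈⟨ -‿inverseʳ 0# ⟩
    0# ∎

  -- The difference in variable `i` is the polynomial of degree `d` in the others. A leading
  -- variable other than `i` is eliminated by setting it to 0 if the degree is 1, and by a
  -- difference otherwise, which preserves the bound on the degree.
  esp-depends : ∀ n d i → suc d ℕ.≤ n →
    ¬ (∀ x → esp n (suc d) (x [ i ≔ 1# ]) ≈ esp n (suc d) (x [ i ≔ 0# ]))
  esp-depends (suc n) d zero (ℕ.s≤s d≤n) h = esp-nonzero n d d≤n λ x → begin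
    esp n d x
      ≈⟨ solve 2 (λ p q → p := (:1 :* p :+ q) :- q) refl (esp n d x) (esp n (suc d) x) ⟩
    (1# * esp n d x + esp n (suc d) x) - esp n (suc d) x
      ≈⟨ +-congʳ (h (0# ∷ x)) ⟩
    (0# * esp n d x + esp n (suc d) x) - esp n (suc d) x
      ≈⟨ solve 2 (λ p q → (:0 :* p :+ q) :- q := :0) refl (esp n d x) (esp n (suc d) x) ⟩
    0# ∎
  esp-depends (suc (suc n)) zero (suc i) _ h = esp-depends (suc n) zero i (ℕ.s≤s ℕ.z≤n) λ x →
    trans (sym (esp-head-0 (suc n) 1 (x [ i ≔ 1# ]))) (trans (h (0# ∷ x)) (esp-head-0 (suc n) 1 (x [ i ≔ 0# ])))
  esp-depends (suc n) (suc d) (suc i) (ℕ.s≤s d<n) h = esp-depends n d i d<n λ x →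
    let x¹ = x [ i ≔ 1# ] ; x⁰ = x [ i ≔ 0# ] in begin
    esp n (suc d) x¹
      ≈⟨ solve 2 (λ p q → p := (:1 :* p :+ q) :- (:0 :* p :+ q)) refl (esp n (suc d) x¹) (esp n (2 ℕ.+ d) x¹) ⟩
    esp (suc n) (2 ℕ.+ d) (1# ∷ x¹) - esp (suc n) (2 ℕ.+ d) (0# ∷ x¹)
      ≈⟨ +-cong (h (1# ∷ x)) (-‿cong (h (0# ∷ x))) ⟩
    esp (suc n) (2 ℕ.+ d) (1# ∷ x⁰) - esp (suc n) (2 ℕ.+ d) (0# ∷ x⁰)
      ≈⟨ solve 2 (λ p q → (:1 :* p :+ q) :- (:0 :* p :+ q) := p) refl (esp n (suc d) x⁰) (esp n (2 ℕ.+ d) x⁰) ⟩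
    esp n (suc d) x⁰ ∎

  -- The two sides differ by the second difference in the variables `i` and `j`, which is the
  -- elementary symmetric polynomial of degree `d` in the remaining ones.
  esp-mixes : ∀ n d i j → i ≢ j → 2 ℕ.+ d ℕ.≤ n →
    ¬ (∀ x → esp n (2 ℕ.+ d) (x [ i ≔ 1# ] [ j ≔ 1# ]) + esp n (2 ℕ.+ d) (x [ i ≔ 0# ] [ j ≔ 0# ]) ≈
             esp n (2 ℕ.+ d) (x [ i ≔ 1# ] [ j ≔ 0# ]) + esp n (2 ℕ.+ d) (x [ i ≔ 0# ] [ j ≔ 1# ]))
  esp-mixes n d zero zero i≢j _ h = i≢j ≡.refl
  esp-mixes (suc n) d zero (suc j) _ (ℕ.s≤s d<n) h = esp-depends n d j d<n λ x →
    let p¹ = esp n (suc d) (x [ j ≔ 1# ]) ; q¹ = esp n (2 ℕ.+ d) (x [ j ≔ 1# ])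
        p⁰ = esp n (suc d) (x [ j ≔ 0# ]) ; q⁰ = esp n (2 ℕ.+ d) (x [ j ≔ 0# ]) in begin
    p¹
      ≈⟨ solve 4 (λ p¹ q¹ p⁰ q⁰ → p¹ := ((:1 :* p¹ :+ q¹) :+ (:0 :* p⁰ :+ q⁰)) :- (q¹ :+ q⁰)) refl p¹ q¹ p⁰ q⁰ ⟩
    ((1# * p¹ + q¹) + (0# * p⁰ + q⁰)) - (q¹ + q⁰)
      ≈⟨ +-congʳ (h (0# ∷ x)) ⟩
    ((1# * p⁰ + q⁰) + (0# * p¹ + q¹)) - (q¹ + q⁰)
      ≈⟨ solve 4 (λ p¹ q¹ p⁰ q⁰ → ((:1 :* p⁰ :+ q⁰) :+ (:0 :* p¹ :+ q¹)) :- (q¹ :+ q⁰) := p⁰) refl p¹ q¹ p⁰ q⁰ ⟩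
    p⁰ ∎
  esp-mixes (suc n) d (suc i) zero _ (ℕ.s≤s d<n) h = esp-depends n d i d<n λ x →
    let p¹ = esp n (suc d) (x [ i ≔ 1# ]) ; q¹ = esp n (2 ℕ.+ d) (x [ i ≔ 1# ])
        p⁰ = esp n (suc d) (x [ i ≔ 0# ]) ; q⁰ = esp n (2 ℕ.+ d) (x [ i ≔ 0# ]) in begin
    p¹
      ≈⟨ solve 4 (λ p¹ q¹ p⁰ q⁰ → p¹ := ((:1 :* p¹ :+ q¹) :+ (:0 :* p⁰ :+ q⁰)) :- (q¹ :+ q⁰)) refl p¹ q¹ p⁰ q⁰ ⟩
    ((1# * p¹ + q¹) + (0# * p⁰ + q⁰)) - (q¹ + q⁰)
      ≈⟨ +-congʳ (h (0# ∷ x)) ⟩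
    ((0# * p¹ + q¹) + (1# * p⁰ + q⁰)) - (q¹ + q⁰)
      ≈⟨ solve 4 (λ p¹ q¹ p⁰ q⁰ → ((:0 :* p¹ :+ q¹) :+ (:1 :* p⁰ :+ q⁰)) :- (q¹ :+ q⁰) := p⁰) refl p¹ q¹ p⁰ q⁰ ⟩
    p⁰ ∎
  esp-mixes (suc (suc zero)) zero (suc zero) (suc zero) i≢j _ h = i≢j ≡.refl
  esp-mixes (suc (suc (suc n))) zero (suc i) (suc j) i≢j _ h =
    esp-mixes (2 ℕ.+ n) zero i j (i≢j ∘ ≡.cong suc) (ℕ.s≤s (ℕ.s≤s ℕ.z≤n)) λ x →
      let drop = λ s t → esp-head-0 (2 ℕ.+ n) 2 (x [ i ≔ s ] [ j ≔ t ]) in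
      trans (sym (+-cong (drop 1# 1#) (drop 0# 0#))) (trans (h (0# ∷ x)) (+-cong (drop 1# 0#) (drop 0# 1#)))
  esp-mixes (suc n) (suc d) (suc i) (suc j) i≢j (ℕ.s≤s d<n) h = esp-mixes n d i j (i≢j ∘ ≡.cong suc) d<n λ x →
    let p = λ s t → esp n (2 ℕ.+ d) (x [ i ≔ s ] [ j ≔ t ]) ; q = λ s t → esp n (3 ℕ.+ d) (x [ i ≔ s ] [ j ≔ t ]) in begin
    p 1# 1# + p 0# 0#
      ≈⟨ solve 4 (λ p¹ q¹ p⁰ q⁰ → p¹ :+ p⁰ := ((:1 :* p¹ :+ q¹) :+ (:1 :* p⁰ :+ q⁰)) :- ((:0 :* p¹ :+ q¹) :+ (:0 :* p⁰ :+ q⁰))) refl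
           (p 1# 1#) (q 1# 1#) (p 0# 0#) (q 0# 0#) ⟩
    ((1# * p 1# 1# + q 1# 1#) + (1# * p 0# 0# + q 0# 0#)) - ((0# * p 1# 1# + q 1# 1#) + (0# * p 0# 0# + q 0# 0#))
      ≈⟨ +-cong (h (1# ∷ x)) (-‿cong (h (0# ∷ x))) ⟩
    ((1# * p 1# 0# + q 1# 0#) + (1# * p 0# 1# + q 0# 1#)) - ((0# * p 1# 0# + q 1# 0#) + (0# * p 0# 1# + q 0# 1#))
      ≈⟨ solve 4 (λ p¹ q¹ p⁰ q⁰ → ((:1 :* p¹ :+ q¹) :+ (:1 :* p⁰ :+ q⁰)) :- ((:0 :* p¹ :+ q¹) :+ (:0 :* p⁰ :+ q⁰)) := p¹ :+ p⁰) refl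
           (p 1# 0#) (q 1# 0#) (p 0# 1#) (q 0# 1#) ⟩
    p 1# 0# + p 0# 1# ∎

  -- The columns of a read-once matrix

  value : ∀ {n} → V n → Entry F {n} → Carrier
  value x (inj₁ i) = x i
  value x (inj₂ a) = a

  eval-entry : ∀ {n} (x : V n) e → eval x (⟦_⟧ F e) ≈ value x e
  eval-entry x (inj₁ i) = eval-var x i
  eval-entry x (inj₂ a) = eval-const x a

  value-unaffected : ∀ {n} (x : V n) i a e → e ≢ inj₁ i → value (x [ i ≔ a ]) e ≡ value x e
  value-unaffected x i a (inj₁ v) e≢i = updateAt-minimal v i x λ v≡i → e≢i (≡.cong inj₁ v≡i)
  value-unaffected x i a (inj₂ b) e≢i = ≡.refl

  isVariable? : ∀ {n} (e : Entry F {n}) i → Dec (e ≡ inj₁ i)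
  isVariable? (inj₁ v) i with v Fin.≟ i
  ... | yes ≡.refl = yes ≡.refl
  ... | no v≢i = no λ { ≡.refl → v≢i ≡.refl }
  isVariable? (inj₂ a) i = no λ ()

  -- An entry is an affine function with slope 1 or 0 in at most one variable.
  value-mixes : ∀ {n} (x : V n) i j → i ≢ j → ∀ e →
    value (x [ i ≔ 1# ] [ j ≔ 1# ]) e ≈
    value (x [ i ≔ 1# ] [ j ≔ 0# ]) e + 1# * (value (x [ i ≔ 0# ] [ j ≔ 1# ]) e - value (x [ i ≔ 0# ] [ j ≔ 0# ]) e)
  value-mixes x i j i≢j (inj₂ a) = solve 1 (λ a → a := a :+ :1 :* (a :- a)) refl a
  value-mixes x i j i≢j (inj₁ v) with v Fin.≟ j
  ... | no v≢j
      rewrite updateAt-minimal v j {const 1#} (x [ i ≔ 1# ]) v≢j | updateAt-minimal v j {const 0#} (x [ i ≔ 1# ]) v≢j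
            | updateAt-minimal v j {const 1#} (x [ i ≔ 0# ]) v≢j | updateAt-minimal v j {const 0#} (x [ i ≔ 0# ]) v≢j
      = solve 2 (λ a b → a := a :+ :1 :* (b :- b)) refl _ _
  ... | yes ≡.refl
      rewrite updateAt-updates j {const 1#} (x [ i ≔ 1# ]) | updateAt-updates j {const 0#} (x [ i ≔ 1# ])
            | updateAt-updates j {const 1#} (x [ i ≔ 0# ]) | updateAt-updates j {const 0#} (x [ i ≔ 0# ])
      = solve 0 (:1 := :0 :+ :1 :* (:1 :- :0)) refl

  δ-diagonal : ∀ {k} (i : Fin k) → δ i i ≈ 1#
  δ-diagonal zero = refl
  δ-diagonal (suc i) = δ-diagonal i

  δ-off-diagonal : ∀ {k} (i j : Fin k) → i ≢ j → δ i j ≈ 0#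
  δ-off-diagonal zero zero i≢j = contradiction ≡.refl i≢j
  δ-off-diagonal zero (suc j) _ = refl
  δ-off-diagonal (suc i) zero _ = refl
  δ-off-diagonal (suc i) (suc j) i≢j = δ-off-diagonal i j (i≢j ∘ ≡.cong suc)

  module _ {n d k : ℕ} (2+d≤n : 2 ℕ.+ d ℕ.≤ n) (M : Fin k → Fin k → Entry F {n}) (once : ReadOnce F M)
           (det≃S : _≃_ F (Defs.det F k (λ r s → ⟦_⟧ F (M r s))) (S F n (2 ℕ.+ d))) where

    private
      module D = Alternating (det-alternating k)

      columns : V n → Fin k → V k
      columns x s r = value x (M r s)

      det-columns : ∀ x → det k (columns x) ≈ esp n (2 ℕ.+ d) x
      det-columns x = begin
        det k (columns x)                                    ≈⟨ D.cong (λ s r → eval-entry x (M r s)) ⟨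
        det k (λ s r → eval x (⟦_⟧ F (M r s)))               ≈⟨ eval-det x k (λ r s → ⟦_⟧ F (M r s)) ⟨
        eval x (Defs.det F k (λ r s → ⟦_⟧ F (M r s)))        ≈⟨ eval-≃ x {Defs.det F k (λ r s → ⟦_⟧ F (M r s))} {S F n (2 ℕ.+ d)} det≃S ⟩
        eval x (S F n (2 ℕ.+ d))                             ≈⟨ eval-S n (2 ℕ.+ d) x ⟩
        esp n (2 ℕ.+ d) x                                    ∎

      -- If `i` did not occur, the determinant could not depend on it.
      position : ∀ i → ∃₂ λ r s → M r s ≡ inj₁ i
      position i with Fin.any? (λ r → Fin.any? (λ s → isVariable? (M r s) i))
      ... | yes p = p
      ... | no absent = contradiction (λ x → begin
        esp n (2 ℕ.+ d) (x [ i ≔ 1# ])   ≈⟨ det-columns _ ⟨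
        det k (columns (x [ i ≔ 1# ]))   ≈⟨ D.cong (λ s r → reflexive (≡.trans (unaffected x 1# r s) (≡.sym (unaffected x 0# r s)))) ⟩
        det k (columns (x [ i ≔ 0# ]))   ≈⟨ det-columns _ ⟩
        esp n (2 ℕ.+ d) (x [ i ≔ 0# ])   ∎) (esp-depends n (suc d) i 2+d≤n)
        where
        unaffected : ∀ x a r s → value (x [ i ≔ a ]) (M r s) ≡ value x (M r s)
        unaffected x a r s = value-unaffected x i a (M r s) λ e → absent (r , s , e)

      row col : Fin n → Fin k
      row i = proj₁ (position i)
      col i = proj₁ (proj₂ (position i))

      at-position : ∀ i → M (row i) (col i) ≡ inj₁ i
      at-position i = proj₂ (proj₂ (position i))

      -- Two variables in one column would never be multiplied with each other.
      col-injective : ∀ {i j} → col i ≡ col j → i ≡ j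
      col-injective {i} {j} same with i Fin.≟ j
      ... | yes i≡j = i≡j
      ... | no i≢j = contradiction mixed (esp-mixes n d i j i≢j 2+d≤n)
        where
        module _ (x : V n) where
          x[_,_] : Carrier → Carrier → V n
          x[ s , t ] = x [ i ≔ s ] [ j ≔ t ]
          slope-column : V k
          slope-column r = value x[ 0# , 1# ] (M r (col j)) - value x[ 0# , 0# ] (M r (col j))
          W : Fin k → V k
          W = updateAt (columns x) (col j) (const slope-column)
          unaffected : ∀ s t c → c ≢ col j → columns x[ s , t ] c ≋ columns x c
          unaffected s t c c≢ r = reflexive (≡.trans
            (value-unaffected (x [ i ≔ s ]) j t (M r c) λ e → c≢ (proj₂ (once _ _ _ _ j e (at-position j))))
            (value-unaffected x i s (M r c) λ e → c≢ (≡.trans (proj₂ (once _ _ _ _ i e (at-position i))) same)))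
          alike : ∀ s t s' t' c → c ≢ col j → columns x[ s , t ] c ≋ columns x[ s' , t' ] c
          alike s t s' t' c c≢ r = trans (unaffected s t c c≢ r) (sym (unaffected s' t' c c≢ r))
          alike-W : ∀ s t c → c ≢ col j → columns x[ s , t ] c ≋ W c
          alike-W s t c c≢ r = trans (unaffected s t c c≢ r) (≡⇒≋ (≡.sym (updateAt-minimal c (col j) (columns x) c≢)) r)
          W-at : ∀ r → slope-column r ≈ W (col j) r
          W-at = ≡⇒≋ (≡.sym (updateAt-updates (col j) (columns x)))
          -- `det k W` is the increment of the determinant as variable `j` goes from 0 to 1. It is
          -- the same for both values `s` of variable `i`: the other columns contain neither
          -- variable, and in the common column the two variables are in different entries.
          step : ∀ s → (∀ r → value x[ s , 1# ] (M r (col j)) ≈ value x[ s , 0# ] (M r (col j)) + 1# * slope-column r) →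
            esp n (2 ℕ.+ d) x[ s , 1# ] ≈ esp n (2 ℕ.+ d) x[ s , 0# ] + 1# * det k W
          step s e = begin
            esp n (2 ℕ.+ d) x[ s , 1# ]                  ≈⟨ det-columns _ ⟨
            det k (columns x[ s , 1# ])                  ≈⟨ D.linear (col j) 1# (alike s 1# s 0#) (alike-W s 1#)
                                                              (λ r → trans (e r) (+-congˡ (*-congˡ (W-at r)))) ⟩
            det k (columns x[ s , 0# ]) + 1# * det k W   ≈⟨ +-congʳ (det-columns _) ⟩
            esp n (2 ℕ.+ d) x[ s , 0# ] + 1# * det k W   ∎
          mixed : esp n (2 ℕ.+ d) x[ 1# , 1# ] + esp n (2 ℕ.+ d) x[ 0# , 0# ] ≈
                  esp n (2 ℕ.+ d) x[ 1# , 0# ] + esp n (2 ℕ.+ d) x[ 0# , 1# ]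
          mixed = begin
            esp n (2 ℕ.+ d) x[ 1# , 1# ] + esp n (2 ℕ.+ d) x[ 0# , 0# ]
              ≈⟨ +-congʳ (step 1# λ r → value-mixes x i j i≢j (M r (col j))) ⟩
            (esp n (2 ℕ.+ d) x[ 1# , 0# ] + 1# * det k W) + esp n (2 ℕ.+ d) x[ 0# , 0# ]
              ≈⟨ solve 3 (λ a b c → (a :+ b) :+ c := a :+ (c :+ b)) refl _ _ _ ⟩
            esp n (2 ℕ.+ d) x[ 1# , 0# ] + (esp n (2 ℕ.+ d) x[ 0# , 0# ] + 1# * det k W)
              ≈⟨ +-congˡ (step 0# λ r → solve 2 (λ a b → a := b :+ :1 :* (a :- b)) refl _ _) ⟨
            esp n (2 ℕ.+ d) x[ 1# , 0# ] + esp n (2 ℕ.+ d) x[ 0# , 1# ] ∎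

    open Overwrite col col-injective (columns (const 0#)) using (overwrite; overwrite-hit; overwrite-miss; overwrite-alternating; slots)

    private
      a e : Fin n → V k
      a i = columns (const 0#) (col i)
      e i = δ (row i)

      -- By `col-injective` a variable met in this column can only be `i`, and `once` then fixes its
      -- row.
      column-line : ∀ x i r → value x (M r (col i)) ≈ value (const 0#) (M r (col i)) + x i * δ (row i) r
      column-line x i r with M r (col i) in eq
      ... | inj₂ b = sym (trans (+-congˡ (trans (*-congˡ (δ-off-diagonal (row i) r λ { ≡.refl → contradiction (≡.trans (≡.sym eq) (at-position i)) λ () })) (zeroʳ _))) (+-identityʳ b))
      ... | inj₁ v with once _ _ _ _ v eq (at-position v)
      ... | r≡row , col≡col with col-injective col≡col
      ... | ≡.refl = begin
        x i                            ≈⟨ solve 1 (λ x → x := :0 :+ x :* :1) refl (x i) ⟩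
        0# + x i * 1#                  ≈⟨ +-congˡ (*-congˡ (δ-diagonal (row i))) ⟨
        0# + x i * δ (row i) (row i)   ≈⟨ +-congˡ (*-congˡ (reflexive (≡.cong (δ (row i)) r≡row))) ⟨
        0# + x i * δ (row i) r         ∎

      constant-column : ∀ x j → (∀ i → col i ≢ j) → ∀ r → value x (M r j) ≈ value (const 0#) (M r j)
      constant-column x j j∉col r with M r j in eq
      ... | inj₂ b = refl
      ... | inj₁ v = contradiction (≡.sym (proj₂ (once _ _ _ _ v eq (at-position v)))) (j∉col v)

    esp-form : ∃₂ λ (a e : Fin n → V k) → ∃ λ (ω : (Fin n → V k) → Carrier) →
      Alternating ω × ExchangeForms.Exchange commRing ω × (∀ x → ω (line a e x) ≈ esp n (2 ℕ.+ d) x)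
    esp-form = a , e , (λ y → det k (overwrite y)) , overwrite-alternating (det-alternating k) ,
      overwrite-exchange col col-injective (columns (const 0#)) , λ x → trans (D.cong (matches x)) (det-columns x)
      where
      matches : ∀ x j → overwrite (line a e x) j ≋ columns x j
      matches x = slots (λ j → overwrite (line a e x) j ≋ columns x j)
        (λ i r → trans (≡⇒≋ (overwrite-hit (line a e x) i) r) (sym (column-line x i r)))
        (λ j j∉col r → trans (≡⇒≋ (overwrite-miss (line a e x) j∉col) r) (sym (constant-column x j j∉col r)))

-- Squares in an ordered field

module Reals {c ℓ} (F : Field c ℓ) (reals : IsReals F) where
  open Field F hiding (zero)
  open IsReals reals renaming (_≤_ to _≤ʳ_)
  open IntegerSolver commRing

  square-nonneg : ∀ x → 0# ≤ʳ (x * x)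
  square-nonneg x with ≤-total 0# x
  ... | inj₁ 0≤x = *-nonneg 0≤x 0≤x
  ... | inj₂ x≤0 = ≤-resp-≈ refl (solve 1 (λ x → (:- x) :* (:- x) := x :* x) refl x) (*-nonneg 0≤-x 0≤-x)
    where
    0≤-x : 0# ≤ʳ (- x)
    0≤-x = ≤-resp-≈ (-‿inverseʳ x) (+-identityˡ (- x)) (+-mono (- x) x≤0)

  -- Adding 3 to 0 ≤ y² = -3 gives 3 ≤ 0, against 1 ≤ 3.
  minus-three-nonresidue : MinusThreeNonResidue F
  minus-three-nonresidue (y , y²≈-3) = 1≉0 (≤-antisym 1≤0 0≤1)
    where
    0≤1 : 0# ≤ʳ 1#
    0≤1 = ≤-resp-≈ refl (*-identityʳ 1#) (square-nonneg 1#)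
    0≤2 : 0# ≤ʳ (1# + 1#)
    0≤2 = ≤-trans 0≤1 (≤-resp-≈ (+-identityˡ 1#) refl (+-mono 1# 0≤1))
    1≤3 : 1# ≤ʳ (1# + 1# + 1#)
    1≤3 = ≤-resp-≈ (+-identityˡ 1#) refl (+-mono 1# 0≤2)
    3≤0 : (1# + 1# + 1#) ≤ʳ 0#
    3≤0 = ≤-resp-≈ (+-identityˡ _) (trans (+-congʳ y²≈-3) (-‿inverseˡ _)) (+-mono (1# + 1# + 1#) (square-nonneg y))
    1≤0 : 1# ≤ʳ 0#
    1≤0 = ≤-trans 1≤3 3≤0

-- Symmetric polynomials are not read-once determinants

theorem5 : ∀ {c ℓ} (F : Field c ℓ) →
    ((IsFinite F × MinusThreeNonResidue F) ⊎ IsReals F) →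
    ∀ (n d : ℕ) → 4 ≤ n → 2 ≤ d → d ≤ n ∸ 2 →
    ¬ IsReadOnceDet F (S F n d)
theorem5 F _ (suc zero) d (ℕ.s≤s ()) _ _
-- With the original number of variables equal to n + 2, the bounds on `d` yield d = 2 + i and n = d
-- + j, that is 4 + (i + j) variables in degree 2 + i.
theorem5 F F-kind (suc (suc n)) d _ 2≤d d≤n (k , M , once , det≃S)
  with ℕ.m≤n⇒∃[o]m+o≡n 2≤d | ℕ.m≤n⇒∃[o]m+o≡n d≤n
... | i , ≡.refl | j , ≡.refl =
  let a , e , ω , alternating , exchange , h = ReadOnce.esp-form F (ℕ.s≤s (ℕ.s≤s (ℕ.m≤n⇒m≤1+n (ℕ.m≤n⇒m≤1+n (ℕ.m≤m+n i j))))) M once det≃S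
  in SymmetricForms.symmetric-form-impossible F (nonresidue F-kind) i j alternating exchange a e h
  where
  nonresidue : (IsFinite F × MinusThreeNonResidue F) ⊎ IsReals F → MinusThreeNonResidue F
  nonresidue (inj₁ (_ , h)) = h
  nonresidue (inj₂ reals) = Reals.minus-three-nonresidue F reals
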